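{- Let $n$ and $m$ be integers such that $n\ge 2m+2$ and $m\ge 1$. Then $$rex(n,(m+1)K_2)=\begin{cases} \dfrac{n\left(\left\lfloor\frac{n}{n-2m}\right\rfloor-1\right)}{2}, & \text{if } \left\lfloor\frac{n}{n-2m}\right\rfloor \text{ is odd};\\[3mm] \dfrac{n\left(\left\lfloor\frac{n}{n-2m}\right\rfloor-2\right)}{2}, & \text{if } \left\lfloor\frac{n}{n-2m}\right\rfloor \text{ is even}.\end{cases}$$
   Context: All graphs are finite, undirected and simple. $(m+1)K_2$ denotes a matching of size $m+1$, i.e. $m+1$ pairwise vertex-disjoint edges. For a graph $F$, a graph is $F$-free if it does not contain $F$ as a (not necessarily induced) subgraph. A graph is regular if all its vertices have the same degree (the edgeless graph is regular of degree $0$). The regular Turán number $rex(n,F)$ is the maximum number of edges in a regular $n$-vertex $F$-free graph. -}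

module Defs where

open import Level using (0ℓ)
open import Data.Nat using (ℕ; _+_; _*_; _∸_; _≤_; _/_; NonZero; >-nonZero; z<s)
open import Data.Nat.Properties using (m<n⇒0<n∸m; <-≤-trans; m<m+n)
open import Data.Fin using (Fin; remQuot)
open import Data.Fin.Properties using (_≟_; _<?_)
open import Data.List using (List; length; filter; allFin; cartesianProduct)
open import Data.Product using (_×_; _,_; proj₁; proj₂; ∃-syntax)
open import Function using (Injective)
open import Relation.Nullary using (¬_; ¬?; _×-dec_)
open import Relation.Binary using (Rel; Decidable; Symmetric; Irreflexive)
open import Relation.Binary.PropositionalEquality using (_≡_; _≢_; refl; sym; ≢-sym)

record Graph (n : ℕ) : Set₁ where
  field
    Adj    : Rel (Fin n) 0ℓ
    Adj?   : Decidable Adj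
    symm   : Symmetric Adj
    irrefl : Irreflexive _≡_ Adj

open Graph public

degree : ∀ {n} → Graph n → Fin n → ℕ
degree {n} G v = length (filter (Adj? G v) (allFin n))

-- Each edge {u , v} is listed once, as the pair with u < v.
edges : ∀ {n} → Graph n → List (Fin n × Fin n)
edges {n} G = filter (λ (u , v) → (u <? v) ×-dec Adj? G u v) (cartesianProduct (allFin n) (allFin n))

edgeCount : ∀ {n} → Graph n → ℕ
edgeCount G = length (edges G)

Regular : ∀ {n} → Graph n → Set
Regular G = ∃[ d ] (∀ v → degree G v ≡ d)

-- F is a (not necessarily induced) subgraph of G, up to isomorphism.
Contains : ∀ {n p} → Graph n → Graph p → Set
Contains {n} {p} G F =
  ∃[ f ] (Injective {A = Fin p} {B = Fin n} _≡_ _≡_ f × (∀ u v → Adj F u v → Adj G (f u) (f v)))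

Free : ∀ {n p} → Graph p → Graph n → Set
Free F G = ¬ Contains G F

K : (p : ℕ) → Graph p
K p = record
  { Adj    = _≢_
  ; Adj?   = λ u v → ¬? (u ≟ v)
  ; symm   = ≢-sym
  ; irrefl = λ u≡v u≢v → u≢v u≡v
  }

-- The disjoint union of k copies of F: remQuot p sends a vertex to
-- (index of its copy , vertex of F).
copies : ∀ {p} (k : ℕ) → Graph p → Graph (k * p)
copies {p} k F = record
  { Adj    = λ u v → copy u ≡ copy v × Adj F (vertex u) (vertex v)
  ; Adj?   = λ u v → (copy u ≟ copy v) ×-dec Adj? F (vertex u) (vertex v)
  ; symm   = λ (e , a) → sym e , symm F a
  ; irrefl = λ { refl (_ , a) → irrefl F refl a }
  }
  where
  copy : Fin (k * p) → Fin k
  copy u = proj₁ (remQuot p u)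
  vertex : Fin (k * p) → Fin p
  vertex u = proj₂ (remQuot {k} p u)

-- IsRex n F r says rex(n , F) = r, i.e. r is the maximum of edgeCount over
-- the regular F-free graphs on n vertices.
record IsRex (n : ℕ) {p : ℕ} (F : Graph p) (r : ℕ) : Set₁ where
  field
    attained   : ∃[ G ] (Regular {n} G × Free F G × edgeCount G ≡ r)
    upperBound : (G : Graph n) → Regular G → Free F G → edgeCount G ≤ r

n∸2m-nonZero : ∀ n m → 2 * m + 2 ≤ n → NonZero (n ∸ 2 * m)
n∸2m-nonZero n m h = >-nonZero (m<n⇒0<n∸m (<-≤-trans (m<m+n (2 * m) z<s) h))

-- ⌊ n / (n - 2m) ⌋
quot : ∀ n m → 2 * m + 2 ≤ n → ℕ
quot n m h = _/_ n (n ∸ 2 * m) {{n∸2m-nonZero n m h}}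

{-# OPTIONS --safe #-}
-- Upper bound.  Put d = n − 2m.  Move vertices that lie in every maximum
-- matching into a set S until every vertex of G − S is missed by some maximum
-- matching of G − S.  By Gallai's lemma, "no maximum matching misses both" is
-- then an equivalence on G − S that contains adjacency, so every vertex missed
-- by a fixed maximum matching has its own odd class, closed under adjacency in
-- G − S, and there are at least d + |S| such classes.  If G is k-regular, a
-- class with at most k vertices sends at least k edges to S, so at most |S|
-- classes are that small; the other d classes are odd of order > k, which
-- gives d(2t + 3) ≤ n as soon as k > 2t.
--
-- Lower bound.  If d(2t + 1) ≤ n, a disjoint union of d circulant 2t-regular
-- graphs of odd order (all but one of them K₂ₜ₊₁) leaves a vertex of each
-- component unmatched, so its matchings have at most (n − d)/2 = m edges.

module Submission where

open import Data.Bool using (true; false; if_then_else_)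
open import Data.Empty using (⊥; ⊥-elim)
open import Data.Fin using (Fin; zero; suc; _↑ˡ_; _↑ʳ_; combine; finToFun; funToFin; remQuot; toℕ; fromℕ; inject₁; splitAt)
open import Data.Fin.Permutation using (permutation)
open import Data.Fin.Permutation.Components using (transpose)
open import Data.Fin.Properties using (_≟_; any?; suc-injective; all?; finToFun-funToFin; ¬∀⟶∃¬; remQuot-combine; combine-remQuot; toℕ-inject₁; toℕ-fromℕ; toℕ<n; splitAt-↑ˡ; splitAt-↑ʳ)
import Data.Fin as Fin using (_<_)
import Data.Fin.Properties as Fin
open import Data.List using (length; filter; cartesianProduct; tabulate; map; _++_)
open import Data.List.Properties using (map-tabulate; filter-++; length-++)
open import Data.Nat using (ℕ; zero; suc; _+_; _*_; _≤_; _<_; z≤n; s≤s; _≤?_; _<?_; >-nonZero; _∸_; _/_; _%_; z<s; ∣_-_∣; NonZero)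
open import Data.Nat.DivMod using (m*n/n≡m; m/n*n≤m; m≡m%n+[m/n]*n; m%n<n; m≥n⇒m/n>0; /-monoˡ-≤)
open import Data.Nat.Divisibility using (_∣_; divides)
open import Data.Nat.Properties using (≤-refl; ≤-antisym; ≤-reflexive; ≤-trans; +-mono-≤; +-mono-<-≤; +-mono-≤-<; +-assoc; +-identityʳ; *-identityˡ; *-zeroʳ; *-identityʳ; +-suc; m≤m+n; m≤n+m; module ≤-Reasoning; *-comm; +-comm; *-assoc; *-monoʳ-≤; *-monoˡ-≤; *-distribˡ-+; +-cancelˡ-≤; +-cancelʳ-≤; +-monoʳ-≤; *-cancelʳ-≤; *-cancelˡ-≤; ≰⇒>; ≮⇒≥; <⇒≱; m≤n⇒∃[o]m+o≡n; +-*-semiring)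
import Data.Nat.Properties as ℕ
open import Data.Nat.Solver using (module +-*-Solver)
open import Data.Product using (_×_; _,_; proj₁; proj₂; ∃; ∃-syntax)
open import Data.Sum using (_⊎_; inj₁; inj₂; [_,_]′)
open import Data.Sum.Relation.Binary.Pointwise using (Pointwise; inj₁; inj₂; drop-inj₁; drop-inj₂; ⊎-symmetric; ⊎-decidable)
open import Data.Unit using (tt)
open import Function using (_∘_; Injective; id; const)
open import Level using (Level; 0ℓ)
open import Relation.Binary using (tri<; tri≈; tri>)
open import Relation.Binary.PropositionalEquality using (_≡_; _≢_; _≗_; refl; sym; trans; cong; cong₂; subst; module ≡-Reasoning)
open import Relation.Nullary using (¬_; Dec; yes; no; does; ¬?; contradiction; _×-dec_; _⊎-dec_; _→-dec_)
open import Relation.Nullary.Decidable using (map′; dec-true; dec-false)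
open import Relation.Unary using (Pred; Decidable)
open import Algebra.Properties.Semiring.Sum +-*-semiring using (sum; sum-cong-≗; ∑-distrib-+; ∑-comm; sum-permute; *-distribˡ-sum; *-distribʳ-sum; sum-init-last)
open import Defs

private variable
  a : Level
  A B C : Set a
  m n : ℕ

-- Counting over finite sets with indicator functions

χ : Dec A → ℕ
χ A? = if does A? then 1 else 0

χ-yes : (A? : Dec A) → A → χ A? ≡ 1
χ-yes (yes _) _ = refl
χ-yes (no ¬a) a = contradiction a ¬a

χ-no : (A? : Dec A) → ¬ A → χ A? ≡ 0
χ-no (yes a) ¬a = contradiction a ¬a
χ-no (no _)  _  = refl

χ-mono : (A? : Dec A) (B? : Dec B) → (A → B) → χ A? ≤ χ B?
χ-mono (no _)  _  _ = z≤n
χ-mono (yes a) B? f = ≤-reflexive (sym (χ-yes B? (f a)))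

χ-cong : (A? : Dec A) (B? : Dec B) → (A → B) → (B → A) → χ A? ≡ χ B?
χ-cong (yes a) B? f _ = sym (χ-yes B? (f a))
χ-cong (no ¬a) B? _ g = sym (χ-no B? (¬a ∘ g))

χ≤1 : (A? : Dec A) → χ A? ≤ 1
χ≤1 (yes _) = ≤-refl
χ≤1 (no _)  = z≤n

χ-⊎ : (A? : Dec A) (B? : Dec B) (C? : Dec C) → (C → A ⊎ B) → χ C? ≤ χ A? + χ B?
χ-⊎ A? B? (no _)  f = z≤n
χ-⊎ A? B? (yes c) f with f c
... | inj₁ a = ≤-trans (≤-reflexive (sym (χ-yes A? a))) (m≤m+n _ _)
... | inj₂ b = ≤-trans (≤-reflexive (sym (χ-yes B? b))) (m≤n+m _ (χ A?))

χ-disjoint-⊎ : (A? : Dec A) (B? : Dec B) → ¬ (A × B) → χ (A? ⊎-dec B?) ≡ χ A? + χ B?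
χ-disjoint-⊎ (yes a) (yes b) ¬ab = contradiction (a , b) ¬ab
χ-disjoint-⊎ (yes a) (no _)  _   = refl
χ-disjoint-⊎ (no _)  (yes _) _   = refl
χ-disjoint-⊎ (no _)  (no _)  _   = refl

χ-×-* : (A? : Dec A) (B? : Dec B) → χ (A? ×-dec B?) ≡ χ A? * χ B?
χ-×-* (yes _) B? = sym (*-identityˡ (χ B?))
χ-×-* (no _)  B? = refl

count : ∀ {P : Pred (Fin n) a} → Decidable P → ℕ
count P? = sum (χ ∘ P?)

sum-mono : {f g : Fin n → ℕ} → (∀ i → f i ≤ g i) → sum f ≤ sum g
sum-mono {zero}  _   = z≤n
sum-mono {suc n} f≤g = +-mono-≤ (f≤g zero) (sum-mono (f≤g ∘ suc))

sum-mono-< : {f g : Fin n → ℕ} (j : Fin n) → (∀ i → f i ≤ g i) → f j < g j → sum f < sum g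
sum-mono-< zero    f≤g fj<gj = +-mono-<-≤ fj<gj (sum-mono (f≤g ∘ suc))
sum-mono-< (suc j) f≤g fj<gj = +-mono-≤-< (f≤g zero) (sum-mono-< j (f≤g ∘ suc) fj<gj)

sum-const : ∀ n c → sum {n} (λ _ → c) ≡ n * c
sum-const zero    c = refl
sum-const (suc n) c = cong (c +_) (sum-const n c)

sum-ones : ∀ n → sum {n} (λ _ → 1) ≡ n
sum-ones n = trans (sum-const n 1) (*-identityʳ n)

count-none : {P : Pred (Fin n) a} (P? : Decidable P) → (∀ i → ¬ P i) → count P? ≡ 0
count-none {n} P? ¬P = trans (sum-cong-≗ λ i → χ-no (P? i) (¬P i)) (trans (sum-const n 0) (*-zeroʳ n))

term≤sum : (f : Fin n → ℕ) (i : Fin n) → f i ≤ sum f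
term≤sum f zero    = m≤m+n _ _
term≤sum f (suc i) = ≤-trans (term≤sum (f ∘ suc) i) (m≤n+m _ (f zero))

sum-↑ : ∀ m {n} (f : Fin (m + n) → ℕ) →
        sum f ≡ sum (λ i → f (i ↑ˡ n)) + sum (λ j → f (m ↑ʳ j))
sum-↑ zero    f = refl
sum-↑ (suc m) f = trans (cong (f zero +_) (sum-↑ m (f ∘ suc))) (sym (+-assoc (f zero) _ _))

count-unique≤1 : {P : Pred (Fin n) a} (P? : Decidable P) →
                 (∀ {i j} → P i → P j → i ≡ j) → count P? ≤ 1
count-unique≤1 {zero}  P? unique = z≤n
count-unique≤1 {suc n} P? unique with P? zero
... | no _  = count-unique≤1 (P? ∘ suc) (λ p q → suc-injective (unique p q))
... | yes p = s≤s (≤-reflexive (count-none (P? ∘ suc) λ i q → contradiction (unique p q) λ ()))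

count-≡ : (j : Fin n) → count (_≟ j) ≡ 1
count-≡ j = ≤-antisym
  (count-unique≤1 (_≟ j) λ p q → trans p (sym q))
  (≤-trans (≤-reflexive (sym (χ-yes (j ≟ j) refl))) (term≤sum _ j))

count-partition : (c : Fin n → Fin m) → sum (λ i → count (λ v → c v ≟ i)) ≡ n
count-partition {n} {m} c = begin
  sum (λ i → sum (λ v → χ (c v ≟ i)))  ≡⟨ ∑-comm (λ i v → χ (c v ≟ i)) ⟩
  sum (λ v → sum (λ i → χ (c v ≟ i)))  ≡⟨ sum-cong-≗ (λ v → trans
                                             (sum-cong-≗ λ i → χ-cong (c v ≟ i) (i ≟ c v) sym sym)
                                             (count-≡ (c v))) ⟩
  sum {n} (λ v → 1)                    ≡⟨ sum-ones n ⟩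
  n                                    ∎
  where open ≡-Reasoning

-- Double counting of the pairs of `x` and `v ≡ h x` with `P v`: each `x` with `P (h x)` is in
-- exactly one pair, and by injectivity each `v` with `P v` is in at most one.
count-injection : {P : Pred (Fin n) a} (P? : Decidable P) (h : Fin m → Fin n) →
                  Injective _≡_ _≡_ h → count (P? ∘ h) ≤ count P?
count-injection {n = n} {m = m} P? h h-inj = begin
  sum (λ x → χ (P? (h x)))                          ≡⟨ sum-cong-≗ (λ x → spread x) ⟩
  sum (λ x → sum (λ v → χ (v ≟ h x ×-dec P? v)))    ≡⟨ ∑-comm (λ x v → χ (v ≟ h x ×-dec P? v)) ⟩
  sum (λ v → sum (λ x → χ (v ≟ h x ×-dec P? v)))    ≤⟨ sum-mono gather ⟩
  sum (λ v → χ (P? v))                              ∎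
  where
  open ≤-Reasoning
  spread : ∀ x → χ (P? (h x)) ≡ sum (λ v → χ (v ≟ h x ×-dec P? v))
  spread x with P? (h x)
  ... | yes p = sym (trans (sum-cong-≗ λ v → χ-cong (v ≟ h x ×-dec P? v) (v ≟ h x) proj₁ λ { refl → refl , p }) (count-≡ (h x)))
  ... | no ¬p = sym (count-none (λ v → v ≟ h x ×-dec P? v) λ { v (refl , p) → ¬p p })
  gather : ∀ v → sum (λ x → χ (v ≟ h x ×-dec P? v)) ≤ χ (P? v)
  gather v with P? v
  ... | yes p = count-unique≤1 (λ x → v ≟ h x ×-dec yes p) λ { (e , _) (e′ , _) → h-inj (trans (sym e) e′) }
  ... | no ¬p = ≤-reflexive (count-none (λ x → v ≟ h x ×-dec no ¬p) λ _ → ¬p ∘ proj₂)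

enumerate : ∀ {P : Pred (Fin n) a} (P? : Decidable P) k → k ≤ count P? →
            ∃[ g ] (Injective {A = Fin k} {B = Fin n} _≡_ _≡_ g × (∀ i → P (g i)))
enumerate P? zero _ = (λ ()) , (λ { {()} }) , λ ()
enumerate {n = suc n} P? k@(suc k′) k≤ with P? zero
... | no _ = let g , inj , Pg = enumerate (P? ∘ suc) k k≤ in
             suc ∘ g , inj ∘ suc-injective , Pg
... | yes p with s≤s k′≤ ← k≤ =
  let g , inj , Pg = enumerate (P? ∘ suc) k′ k′≤ in
  (λ { zero → zero ; (suc i) → suc (g i) }) ,
  (λ { {zero} {zero} _ → refl ; {suc i} {suc j} e → cong suc (inj (suc-injective e)) }) ,
  (λ { zero → p ; (suc i) → Pg i })

module _ (f : Fin n → Fin n) (f-inv : ∀ v → f (f v) ≡ v) where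

  sum-involution : (g : Fin n → ℕ) → sum g ≡ sum (g ∘ f)
  sum-involution g = sum-permute g (permutation f f f-inv f-inv)

  module _ {P : Pred (Fin n) a} (P? : Decidable P) (P-closed : ∀ {v} → P v → P (f v)) where

    -- The points moved upwards by f are exchanged by f with those moved downwards.
    count-moved : count (λ v → P? v ×-dec ¬? (f v ≟ v)) ≡
                  2 * count (λ v → P? v ×-dec v Fin.<? f v)
    count-moved = begin
      count (λ v → P? v ×-dec ¬? (f v ≟ v))
        ≡⟨ sum-cong-≗ split ⟩
      sum (λ v → up v + down v)
        ≡⟨ ∑-distrib-+ up down ⟩
      sum up + sum down
        ≡⟨ cong (sum up +_) (trans (sum-involution down) (sum-cong-≗ down∘f)) ⟩
      sum up + sum up
        ≡⟨ cong (sum up +_) (sym (+-identityʳ (sum up))) ⟩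
      2 * sum up ∎
      where
      open ≡-Reasoning
      up down : Fin n → ℕ
      up   v = χ (P? v ×-dec v Fin.<? f v)
      down v = χ (P? v ×-dec f v Fin.<? v)
      split : ∀ v → χ (P? v ×-dec ¬? (f v ≟ v)) ≡ up v + down v
      split v = trans
        (χ-cong (P? v ×-dec ¬? (f v ≟ v)) ((P? v ×-dec v Fin.<? f v) ⊎-dec (P? v ×-dec f v Fin.<? v))
          (λ (p , ne) → case p ne)
          (λ { (inj₁ (p , lt)) → p , λ e → Fin.<⇒≢ lt (sym e)
             ; (inj₂ (p , lt)) → p , Fin.<⇒≢ lt }))
        (χ-disjoint-⊎ (P? v ×-dec v Fin.<? f v) (P? v ×-dec f v Fin.<? v)
          (λ ((_ , lt) , (_ , gt)) → Fin.<-asym lt gt))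
        where
        case : P v → f v ≢ v → (P v × v Fin.< f v) ⊎ (P v × f v Fin.< v)
        case p ne with Fin.<-cmp v (f v)
        ... | tri< lt _ _ = inj₁ (p , lt)
        ... | tri≈ _ e _  = contradiction (sym e) ne
        ... | tri> _ _ gt = inj₂ (p , gt)
      down∘f : ∀ v → down (f v) ≡ up v
      down∘f v = χ-cong (P? (f v) ×-dec f (f v) Fin.<? f v) (P? v ×-dec v Fin.<? f v)
        (λ (p , lt) → subst P (f-inv v) (P-closed p) , subst (Fin._< f v) (f-inv v) lt)
        (λ (p , lt) → P-closed p , subst (Fin._< f v) (sym (f-inv v)) lt)

-- Degrees and edge counts as sums

length-filter-tabulate : {A : Set} {P : Pred A a} (P? : Decidable P) (g : Fin n → A) →
                         length (filter P? (tabulate g)) ≡ sum (λ i → χ (P? (g i)))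
length-filter-tabulate {n = zero}  P? g = refl
length-filter-tabulate {n = suc n} P? g with does (P? (g zero))
... | true  = cong suc (length-filter-tabulate P? (g ∘ suc))
... | false = length-filter-tabulate P? (g ∘ suc)

degree-sum : (G : Graph n) (v : Fin n) → degree G v ≡ count (Adj? G v)
degree-sum G v = length-filter-tabulate (Adj? G v) id

length-filter-product : {A B : Set} {P : Pred (A × B) a} (P? : Decidable P) (g : Fin m → A) (h : Fin n → B) →
  length (filter P? (cartesianProduct (tabulate g) (tabulate h))) ≡ sum (λ i → sum (λ j → χ (P? (g i , h j))))
length-filter-product {m = zero}  P? g h = refl
length-filter-product {m = suc m} P? g h = begin
  length (filter P? (map (g zero ,_) (tabulate h) ++ rest))
    ≡⟨ cong length (filter-++ P? (map (g zero ,_) (tabulate h)) rest) ⟩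
  length (filter P? (map (g zero ,_) (tabulate h)) ++ filter P? rest)
    ≡⟨ length-++ (filter P? (map (g zero ,_) (tabulate h))) ⟩
  length (filter P? (map (g zero ,_) (tabulate h))) + length (filter P? rest)
    ≡⟨ cong₂ _+_ (trans (cong (length ∘ filter P?) (map-tabulate h (g zero ,_)))
                        (length-filter-tabulate P? (λ j → g zero , h j)))
                 (length-filter-product P? (g ∘ suc) h) ⟩
  sum (λ j → χ (P? (g zero , h j))) + sum (λ i → sum (λ j → χ (P? (g (suc i) , h j)))) ∎
  where
  open ≡-Reasoning
  rest = cartesianProduct (tabulate (g ∘ suc)) (tabulate h)

-- The ordered adjacent pairs split into ascending and descending ones. Exchanging the order of
-- summation and using the symmetry of `Adj` turns the descending half into the ascending one.
handshake : (G : Graph n) → 2 * edgeCount G ≡ sum (degree G)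
handshake {n} G = sym (begin
  sum (degree G)                               ≡⟨ sum-cong-≗ (degree-sum G) ⟩
  sum (λ u → sum (λ v → χ (Adj? G u v)))       ≡⟨ sum-cong-≗ (λ u → trans (sum-cong-≗ (split u)) (∑-distrib-+ (up u) (down u))) ⟩
  sum (λ u → sum (up u) + sum (down u))        ≡⟨ ∑-distrib-+ (sum ∘ up) (sum ∘ down) ⟩
  sum (sum ∘ up) + sum (sum ∘ down)            ≡⟨ cong (sum (sum ∘ up) +_) (∑-comm down) ⟩
  sum (sum ∘ up) + sum (λ v → sum (λ u → down u v))
    ≡⟨ cong (sum (sum ∘ up) +_) (sum-cong-≗ λ v → sum-cong-≗ λ u →
         χ-cong (v Fin.<? u ×-dec Adj? G u v) (v Fin.<? u ×-dec Adj? G v u)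
           (λ (lt , uv) → lt , symm G uv) (λ (lt , vu) → lt , symm G vu)) ⟩
  sum (sum ∘ up) + sum (sum ∘ up)              ≡⟨ cong (sum (sum ∘ up) +_) (sym (+-identityʳ _)) ⟩
  2 * sum (sum ∘ up)                           ≡⟨ cong (2 *_) (length-filter-product {m = n} {n = n} (λ (u , v) → u Fin.<? v ×-dec Adj? G u v) id id) ⟨
  2 * edgeCount G                              ∎)
  where
  open ≡-Reasoning
  up down : Fin n → Fin n → ℕ
  up   u v = χ (u Fin.<? v ×-dec Adj? G u v)
  down u v = χ (v Fin.<? u ×-dec Adj? G u v)
  split : ∀ u v → χ (Adj? G u v) ≡ up u v + down u v
  split u v = trans
    (χ-cong (Adj? G u v) ((u Fin.<? v ×-dec Adj? G u v) ⊎-dec (v Fin.<? u ×-dec Adj? G u v))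
      case (λ { (inj₁ (_ , uv)) → uv ; (inj₂ (_ , uv)) → uv }))
    (χ-disjoint-⊎ (u Fin.<? v ×-dec Adj? G u v) (v Fin.<? u ×-dec Adj? G u v)
      (λ ((lt , _) , (gt , _)) → Fin.<-asym lt gt))
    where
    case : Adj G u v → _
    case uv with Fin.<-cmp u v
    ... | tri< lt _ _ = inj₁ (lt , uv)
    ... | tri≈ _ e _  = contradiction uv (irrefl G e)
    ... | tri> _ _ gt = inj₂ (gt , uv)

regular-edgeCount : (G : Graph n) {k : ℕ} → (∀ v → degree G v ≡ k) → 2 * edgeCount G ≡ n * k
regular-edgeCount {n} G {k} reg = trans (handshake G) (trans (sum-cong-≗ reg) (sum-const n k))

-- Matchings as involutions

-- Functions are coded by a finite type and searched there. Decoding a code gives the function back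
-- only pointwise, hence the demand that `P` respect `≗`.
∃-function? : {P : (Fin m → Fin n) → Set} → (∀ f → Dec (P f)) →
              (∀ {f g} → f ≗ g → P f → P g) → Dec (∃ P)
∃-function? {m} {n} P? resp = map′
  (λ (i , p) → finToFun i , p)
  (λ (f , p) → funToFin f , resp (sym ∘ finToFun-funToFin f) p)
  (any? (λ i → P? (finToFun i)))

-- Abstract, so that case splits on equality of vertices do not reach the tests inside transpose.
abstract
  swap : Fin n → Fin n → Fin n → Fin n
  swap = transpose

  swap-first : (i j : Fin n) → swap i j i ≡ j
  swap-first i j rewrite dec-true (i ≟ i) refl = refl

  swap-second : (i j : Fin n) → swap i j j ≡ i
  swap-second i j with j ≟ i
  ... | yes j≡i = j≡i
  ... | no _ rewrite dec-true (j ≟ j) refl = refl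

  swap-other : {i j k : Fin n} → k ≢ i → k ≢ j → swap i j k ≡ k
  swap-other {i = i} {j} {k} k≢i k≢j
    rewrite dec-false (k ≟ i) k≢i | dec-false (k ≟ j) k≢j = refl

swap-involutive : (i j k : Fin n) → swap i j (swap i j k) ≡ k
swap-involutive i j k with k ≟ i | k ≟ j
... | yes refl | _        = trans (cong (swap i j) (swap-first i j)) (swap-second i j)
... | no _     | yes refl = trans (cong (swap i j) (swap-second i j)) (swap-first i j)
... | no k≢i   | no k≢j   = trans (cong (swap i j) (swap-other k≢i k≢j)) (swap-other k≢i k≢j)

-- A matching is the involution exchanging the two ends of each of its edges;
-- unmatched vertices are its fixed points.
record IsMatching (G : Graph n) (S : Pred (Fin n) 0ℓ) (f : Fin n → Fin n) : Set where
  field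
    involutive : ∀ v → f (f v) ≡ v
    adjacent   : ∀ v → f v ≢ v → Adj G v (f v)
    avoids     : ∀ v → S v → f v ≡ v

  matched∉ : ∀ {v} → f v ≢ v → ¬ S v
  matched∉ fv≢v Sv = fv≢v (avoids _ Sv)

  partner-matched : ∀ {v} → f v ≢ v → f (f v) ≢ f v
  partner-matched fv≢v e = fv≢v (trans (sym e) (involutive _))

  unmatched-partner : ∀ {v w} → f w ≡ w → f v ≡ w → v ≡ w
  unmatched-partner {v} fw≡w refl = trans (sym (involutive v)) fw≡w

open IsMatching

unmatched : (Fin n → Fin n) → ℕ
unmatched f = count (λ v → f v ≟ v)

isMatching? : (G : Graph n) {S : Pred (Fin n) 0ℓ} → Decidable S → ∀ f → Dec (IsMatching G S f)
isMatching? G S? f = map′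
  (λ (i , a , s) → record { involutive = i ; adjacent = a ; avoids = s })
  (λ M → involutive M , adjacent M , avoids M)
  (all? (λ v → f (f v) ≟ v)
    ×-dec all? (λ v → ¬? (f v ≟ v) →-dec Adj? G v (f v))
    ×-dec all? (λ v → S? v →-dec f v ≟ v))

isMatching-resp : {G : Graph n} {S : Pred (Fin n) 0ℓ} {f g : Fin n → Fin n} →
                  f ≗ g → IsMatching G S f → IsMatching G S g
isMatching-resp {G = G} {f = f} {g} f≗g M = record
  { involutive = λ v → trans (trans (sym (f≗g (g v))) (cong f (sym (f≗g v)))) (involutive M v)
  ; adjacent   = λ v gv≢v → subst (Adj G v) (f≗g v) (adjacent M v (gv≢v ∘ trans (sym (f≗g v))))
  ; avoids     = λ v Sv → trans (sym (f≗g v)) (avoids M v Sv)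
  }

unmatched-resp : {f g : Fin n → Fin n} → f ≗ g → unmatched f ≡ unmatched g
unmatched-resp {f = f} {g} f≗g = sum-cong-≗ λ v →
  χ-cong (f v ≟ v) (g v ≟ v) (trans (sym (f≗g v))) (trans (f≗g v))

-- Every vertex is fixed or moved, and `f` pairs up the moved ones. The inner count is the number of
-- edges of the matching, each taken at its lower end; `yes tt` is the trivial predicate that makes
-- `count-moved` applicable.
unmatched+moved : (f : Fin n → Fin n) → (∀ v → f (f v) ≡ v) →
                  unmatched f + 2 * count (λ v → yes tt ×-dec v Fin.<? f v) ≡ n
unmatched+moved {n} f f-inv = begin
  unmatched f + 2 * count (λ v → yes tt ×-dec v Fin.<? f v)
    ≡⟨ cong (unmatched f +_) (count-moved f f-inv (λ _ → yes tt) _) ⟨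
  unmatched f + count (λ v → yes tt ×-dec ¬? (f v ≟ v))
    ≡⟨ ∑-distrib-+ (λ v → χ (f v ≟ v)) (λ v → χ (yes tt ×-dec ¬? (f v ≟ v))) ⟨
  sum (λ v → χ (f v ≟ v) + χ (yes tt ×-dec ¬? (f v ≟ v)))
    ≡⟨ sum-cong-≗ one ⟩
  sum {n} (λ _ → 1)
    ≡⟨ sum-ones n ⟩
  n ∎
  where
  open ≡-Reasoning
  one : ∀ v → χ (f v ≟ v) + χ (yes tt ×-dec ¬? (f v ≟ v)) ≡ 1
  one v with f v ≟ v
  ... | yes _ = refl
  ... | no _  = refl

-- If the matching had `m + 1` edges, their lower ends `g i` and upper ends `f (g i)` would form a
-- copy of the forbidden graph.
free⇒unmatched : (G : Graph n) {S : Pred (Fin n) 0ℓ} → Free (copies (suc m) (K 2)) G →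
                 ∀ f → IsMatching G S f → n ≤ unmatched f + 2 * m
free⇒unmatched {n} {m} G free f M with suc m ≤? count (λ v → yes tt ×-dec v Fin.<? f v)
... | no ≰c = ≤-trans (≤-reflexive (sym (unmatched+moved f (involutive M))))
                      (+-monoʳ-≤ (unmatched f) (*-monoʳ-≤ 2 (ℕ.≤-pred (≰⇒> ≰c))))
... | yes ≤c = ⊥-elim (free (h ∘ remQuot 2 , (λ {x} {y} → inj {x} {y}) , edge))
  where
  enum = enumerate (λ v → yes tt ×-dec v Fin.<? f v) (suc m) ≤c
  g = proj₁ enum
  g-inj = proj₁ (proj₂ enum)
  g< : ∀ i → g i Fin.< f (g i)
  g< i = proj₂ (proj₂ (proj₂ enum) i)
  f-inj : ∀ {v w} → f v ≡ f w → v ≡ w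
  f-inj {v} {w} e = trans (sym (involutive M v)) (trans (cong f e) (involutive M w))
  h : Fin (suc m) × Fin 2 → Fin n
  h (i , zero)     = g i
  h (i , suc zero) = f (g i)
  -- A vertex that is the lower end of one edge and the upper end of another would lie both below
  -- and above its partner.
  crossed : ∀ i j → g i ≢ f (g j)
  crossed i j e = Fin.<-asym (g< j) (subst (Fin._< g j) e
    (subst (g i Fin.<_) (trans (cong f e) (involutive M (g j))) (g< i)))
  h-inj : ∀ {p q} → h p ≡ h q → p ≡ q
  h-inj {i , zero}     {j , zero}     e = cong (_, zero) (g-inj e)
  h-inj {i , zero}     {j , suc zero} e = contradiction e (crossed i j)
  h-inj {i , suc zero} {j , zero}     e = contradiction (sym e) (crossed j i)
  h-inj {i , suc zero} {j , suc zero} e = cong (_, suc zero) (g-inj (f-inj e))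
  inj : Injective _≡_ _≡_ (h ∘ remQuot 2)
  inj {x} {y} e = trans (sym (combine-remQuot {suc m} 2 x))
    (trans (cong (λ p → combine (proj₁ p) (proj₂ p)) (h-inj {remQuot 2 x} {remQuot 2 y} e)) (combine-remQuot {suc m} 2 y))
  h-edge : ∀ p q → proj₁ p ≡ proj₁ q → proj₂ p ≢ proj₂ q → Adj G (h p) (h q)
  h-edge (i , zero)     (.i , zero)     refl a≢b = contradiction refl a≢b
  h-edge (i , zero)     (.i , suc zero) refl _   = adjacent M (g i) (Fin.<⇒≢ (g< i) ∘ sym)
  h-edge (i , suc zero) (.i , zero)     refl _   = symm G (adjacent M (g i) (Fin.<⇒≢ (g< i) ∘ sym))
  h-edge (i , suc zero) (.i , suc zero) refl a≢b = contradiction refl a≢b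
  edge : ∀ u v → Adj (copies (suc m) (K 2)) u v → Adj G (h (remQuot 2 u)) (h (remQuot 2 v))
  edge u v (same , a≢b) = h-edge (remQuot 2 u) (remQuot 2 v) same a≢b

-- Maximum matchings of G - S and Gallai's lemma

module MaximumMatchings (G : Graph n) {S : Pred (Fin n) 0ℓ} (S? : Decidable S) (r : ℕ)
  (r-min : ∀ f → IsMatching G S f → r ≤ unmatched f) where

  -- As `r` bounds the number of unmatched vertices from below, attaining it characterises maximum
  -- matchings of G - S. The vertices of `S` are fixed points and are included in `r`.
  Maximum : (Fin n → Fin n) → Set
  Maximum f = IsMatching G S f × unmatched f ≡ r

  -- The negation is the equivalence relation of Gallai's lemma. The diagonal case `MissBoth v v`
  -- says that some maximum matching misses `v`.
  MissBoth : Fin n → Fin n → Set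
  MissBoth u v = ∃[ f ] (Maximum f × f u ≡ u × f v ≡ v)

  missBoth? : ∀ u v → Dec (MissBoth u v)
  missBoth? u v = ∃-function?
    (λ f → (isMatching? G S? f ×-dec unmatched f ℕ.≟ r) ×-dec (f u ≟ u ×-dec f v ≟ v))
    (λ f≗g ((M , e) , fu , fv) →
      (isMatching-resp f≗g M , trans (sym (unmatched-resp f≗g)) e) ,
      trans (sym (f≗g u)) fu , trans (sym (f≗g v)) fv)

  missBoth-sym : ∀ {u v} → MissBoth u v → MissBoth v u
  missBoth-sym (f , M , fu , fv) = f , M , fv , fu

  -- Since `f` fixes `x` and `y`, composing it with their transposition adds the edge {x , y} and
  -- changes nothing else; fewer than `r` vertices would then be unmatched.
  missed-nonadjacent : ∀ {x y} → MissBoth x y → ¬ S x → ¬ S y → ¬ Adj G x y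
  missed-nonadjacent {x} {y} (f , (M , fr) , fx , fy) x∉ y∉ xy =
    <⇒≱ (sum-mono-< x fewer strict) (≤-trans (≤-reflexive fr) (r-min g g-matching))
    where
    g : Fin n → Fin n
    g = swap x y ∘ f
    gx : g x ≡ y
    gx = trans (cong (swap x y) fx) (swap-first x y)
    gy : g y ≡ x
    gy = trans (cong (swap x y) fy) (swap-second x y)
    g-other : ∀ {w} → w ≢ x → w ≢ y → g w ≡ f w
    g-other w≢x w≢y = swap-other (w≢x ∘ unmatched-partner M fx) (w≢y ∘ unmatched-partner M fy)
    x≢y : x ≢ y
    x≢y x≡y = irrefl G x≡y xy
    g-matching : IsMatching G S g
    involutive g-matching w with w ≟ x | w ≟ y
    ... | yes refl | _        = trans (cong g gx) gy
    ... | no _     | yes refl = trans (cong g gy) gx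
    ... | no w≢x   | no w≢y   = trans (cong g (g-other w≢x w≢y))
      (trans (g-other (w≢x ∘ unmatched-partner M fx) (w≢y ∘ unmatched-partner M fy)) (involutive M w))
    adjacent g-matching w gw≢w with w ≟ x | w ≟ y
    ... | yes refl | _        = subst (Adj G x) (sym gx) xy
    ... | no _     | yes refl = subst (Adj G y) (sym gy) (symm G xy)
    ... | no w≢x   | no w≢y   = subst (Adj G w) (sym (g-other w≢x w≢y))
      (adjacent M w (gw≢w ∘ trans (g-other w≢x w≢y)))
    avoids g-matching w Sw = trans (g-other (λ { refl → x∉ Sw }) (λ { refl → y∉ Sw })) (avoids M w Sw)
    fewer : ∀ w → χ (g w ≟ w) ≤ χ (f w ≟ w)
    fewer w with w ≟ x | w ≟ y
    ... | yes refl | _        = ≤-trans (≤-reflexive (χ-no (g x ≟ x) λ e → x≢y (trans (sym e) gx))) z≤n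
    ... | no _     | yes refl = ≤-trans (≤-reflexive (χ-no (g y ≟ y) λ e → x≢y (trans (sym gy) e))) z≤n
    ... | no w≢x   | no w≢y   = χ-mono (g w ≟ w) (f w ≟ w) (trans (sym (g-other w≢x w≢y)))
    strict : χ (g x ≟ x) < χ (f x ≟ x)
    strict = subst (_< χ (f x ≟ x)) (sym (χ-no (g x ≟ x) λ e → x≢y (trans (sym e) gx)))
                   (≤-reflexive (sym (χ-yes (f x ≟ x) fx)))

  agreement : (f g : Fin n → Fin n) → ℕ
  agreement f g = count (λ v → f v ≟ g v)

  -- Replace the edge {y , f y} by {x , y}, where x is missed by f:
  -- this is conjugation by the transposition of x and f y.
  module Rotation {f : Fin n → Fin n} (f-max : Maximum f) {x y : Fin n}
    (fx : f x ≡ x) (fy≢y : f y ≢ y) (x∉ : ¬ S x) (xy : Adj G x y) where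

    private
      M = proj₁ f-max
      z = f y
      τ = swap x z
      fz : f z ≡ y
      fz = involutive M y
      x≢y : x ≢ y
      x≢y refl = fy≢y fx
      x≢z : x ≢ z
      x≢z x≡z = x≢y (sym (unmatched-partner M fx (sym x≡z)))

    rotate : Fin n → Fin n
    rotate w = τ (f (τ w))

    rotate-x : rotate x ≡ y
    rotate-x = trans (cong (τ ∘ f) (swap-first x z))
      (trans (cong τ fz) (swap-other (x≢y ∘ sym) (fy≢y ∘ sym)))

    rotate-y : rotate y ≡ x
    rotate-y = trans (cong (τ ∘ f) (swap-other (x≢y ∘ sym) (fy≢y ∘ sym))) (swap-second x z)

    rotate-z : rotate z ≡ z
    rotate-z = trans (cong (τ ∘ f) (swap-second x z)) (trans (cong τ fx) (swap-first x z))

    rotate-other : ∀ {w} → w ≢ x → w ≢ y → w ≢ z → rotate w ≡ f w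
    rotate-other w≢x w≢y w≢z = trans (cong (τ ∘ f) (swap-other w≢x w≢z))
      (swap-other (w≢x ∘ unmatched-partner M fx)
        (λ fw≡z → w≢y (trans (sym (involutive M _)) (trans (cong f fw≡z) fz))))

    rotate-missed : ∀ {w} → f w ≡ w → w ≢ x → rotate w ≡ w
    rotate-missed {w} fw w≢x = trans (rotate-other w≢x (λ { refl → fy≢y fw })
      (λ { refl → fy≢y (trans (sym fw) fz) })) fw

    rotate-maximum : Maximum rotate
    rotate-maximum = matching , trans same-size (proj₂ f-max)
      where
      matching : IsMatching G S rotate
      involutive matching w = trans (cong (τ ∘ f) (swap-involutive x z (f (τ w))))
        (trans (cong τ (involutive M (τ w))) (swap-involutive x z w))
      adjacent matching w moved with w ≟ x | w ≟ y | w ≟ z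
      ... | yes refl | _        | _        = subst (Adj G x) (sym rotate-x) xy
      ... | no _     | yes refl | _        = subst (Adj G y) (sym rotate-y) (symm G xy)
      ... | no _     | no _     | yes refl = contradiction rotate-z moved
      ... | no w≢x   | no w≢y   | no w≢z   = subst (Adj G w) (sym e) (adjacent M w (moved ∘ trans e))
        where e = rotate-other w≢x w≢y w≢z
      avoids matching w Sw = rotate-missed (avoids M w Sw) (λ { refl → x∉ Sw })
      -- Conjugation by `τ` carries the fixed points of `f` to those of `rotate`.
      same-size : unmatched rotate ≡ unmatched f
      same-size = trans (sum-involution τ (swap-involutive x z) (λ w → χ (rotate w ≟ w)))
        (sum-cong-≗ λ w → χ-cong (rotate (τ w) ≟ τ w) (f w ≟ w)
          (λ e → trans (sym (τττ w)) (trans (cong τ e) (swap-involutive x z w)))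
          (λ e → trans (cong (τ ∘ f) (swap-involutive x z w)) (cong τ e)))
        where
        τττ : ∀ w → τ (rotate (τ w)) ≡ f w
        τττ w = trans (swap-involutive x z (f (τ (τ w)))) (cong f (swap-involutive x z w))

    -- Only `x`, `y` and `z` change. The rotated matching agrees with `g` at `x` and `y`, while `f`
    -- did not at `x`. Nothing is lost at `z`: `g z ≡ f z` would make `z` the `g`-partner of `y`,
    -- which is `x`.
    rotate-agreement : ∀ {g} → (∀ v → g (g v) ≡ v) → g x ≡ y → agreement g f < agreement g rotate
    rotate-agreement {g} g-inv gx = sum-mono-< x more strict
      where
      gy : g y ≡ x
      gy = trans (cong g (sym gx)) (g-inv x)
      more : ∀ w → χ (g w ≟ f w) ≤ χ (g w ≟ rotate w)
      more w with w ≟ x | w ≟ y | w ≟ z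
      ... | yes refl | _        | _        = χ-mono (g x ≟ f x) (g x ≟ rotate x) λ _ → trans gx (sym rotate-x)
      ... | no _     | yes refl | _        = χ-mono (g y ≟ f y) (g y ≟ rotate y) λ _ → trans gy (sym rotate-y)
      ... | no _     | no _     | yes refl = χ-mono (g z ≟ f z) (g z ≟ rotate z) λ e →
        contradiction (trans (sym gy) (trans (cong g (sym (trans e fz))) (g-inv z))) x≢z
      ... | no w≢x   | no w≢y   | no w≢z   = χ-mono (g w ≟ f w) (g w ≟ rotate w) λ e →
        trans e (sym (rotate-other w≢x w≢y w≢z))
      strict : χ (g x ≟ f x) < χ (g x ≟ rotate x)
      strict = subst (_< χ (g x ≟ rotate x))
        (sym (χ-no (g x ≟ f x) λ e → x≢y (trans (sym fx) (trans (sym e) gx))))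
        (≤-reflexive (sym (χ-yes (g x ≟ rotate x) (trans gx (sym rotate-x)))))

  -- Both matchings miss `r` vertices, and `u` and `v` are missed by `f` alone. Hence at least two
  -- vertices are missed by `g` alone, and one of them differs from `t`.
  matched-by-first : ∀ {f g u v t} → Maximum f → Maximum g → u ≢ v → f u ≡ u → f v ≡ v →
                     g u ≢ u → g v ≢ v → ∃[ x ] (x ≢ t × g x ≡ x × f x ≢ x)
  matched-by-first {f} {g} {u} {v} {t} f-max g-max u≢v fu fv gu gv
    with any? (λ x → ¬? (x ≟ t) ×-dec (g x ≟ x ×-dec ¬? (f x ≟ x)))
  ... | yes found = found
  ... | no none = contradiction r+2≤r+1 (<⇒≱ (ℕ.+-monoʳ-< r ≤-refl))
    where
    open ≤-Reasoning
    -- Without such an `x`, the `r + 2` vertices that are missed by `g` or equal to `u` or `v` lie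
    -- among the vertices missed by `f` together with `t`.
    at-most : ∀ w → g w ≡ w ⊎ (w ≡ u ⊎ w ≡ v) → f w ≡ w ⊎ w ≡ t
    at-most w (inj₂ (inj₁ refl)) = inj₁ fu
    at-most w (inj₂ (inj₂ refl)) = inj₁ fv
    at-most w (inj₁ gw) with w ≟ t | f w ≟ w
    ... | yes w≡t | _      = inj₂ w≡t
    ... | no _    | yes fw = inj₁ fw
    ... | no w≢t  | no fw  = contradiction (w , w≢t , gw , fw) none
    pointwise : ∀ w → χ (g w ≟ w) + (χ (w ≟ u) + χ (w ≟ v)) ≤ χ (f w ≟ w) + χ (w ≟ t)
    pointwise w = begin
      χ (g w ≟ w) + (χ (w ≟ u) + χ (w ≟ v))
        ≡⟨ cong (χ (g w ≟ w) +_) (χ-disjoint-⊎ (w ≟ u) (w ≟ v) λ { (refl , e) → u≢v e }) ⟨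
      χ (g w ≟ w) + χ (w ≟ u ⊎-dec w ≟ v)
        ≡⟨ χ-disjoint-⊎ (g w ≟ w) (w ≟ u ⊎-dec w ≟ v)
             (λ { (gw , inj₁ refl) → gu gw ; (gw , inj₂ refl) → gv gw }) ⟨
      χ (g w ≟ w ⊎-dec (w ≟ u ⊎-dec w ≟ v))
        ≤⟨ χ-⊎ (f w ≟ w) (w ≟ t) (g w ≟ w ⊎-dec (w ≟ u ⊎-dec w ≟ v)) (at-most w) ⟩
      χ (f w ≟ w) + χ (w ≟ t) ∎
    r+2≤r+1 : r + 2 ≤ r + 1
    r+2≤r+1 = begin
      r + 2
        ≡⟨ cong₂ _+_ (proj₂ g-max) (cong₂ _+_ (count-≡ u) (count-≡ v)) ⟨
      unmatched g + (count (_≟ u) + count (_≟ v))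
        ≡⟨ cong (unmatched g +_) (∑-distrib-+ (λ w → χ (w ≟ u)) (λ w → χ (w ≟ v))) ⟨
      unmatched g + sum (λ w → χ (w ≟ u) + χ (w ≟ v))
        ≡⟨ ∑-distrib-+ (λ w → χ (g w ≟ w)) (λ w → χ (w ≟ u) + χ (w ≟ v)) ⟨
      sum (λ w → χ (g w ≟ w) + (χ (w ≟ u) + χ (w ≟ v)))
        ≤⟨ sum-mono pointwise ⟩
      sum (λ w → χ (f w ≟ w) + χ (w ≟ t))
        ≡⟨ ∑-distrib-+ (λ w → χ (f w ≟ w)) (λ w → χ (w ≟ t)) ⟩
      unmatched f + count (_≟ t)
        ≡⟨ cong₂ _+_ (proj₂ f-max) (count-≡ t) ⟩
      r + 1 ∎

  -- Rotating g towards f keeps t missed, and terminates because the agreement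
  -- with f increases; a rotation is possible while g matches both u and v.
  gallai : ∀ {u v t} → u ≢ v → MissBoth u v → MissBoth t t → MissBoth u t ⊎ MissBoth t v
  gallai {u} {v} {t} u≢v (f , f-max , fu , fv) (g₀ , g₀-max , g₀t , _) =
    go (suc n) g₀ g₀-max g₀t (m≤m+n (suc n) _)
    where
    F = proj₁ f-max
    agreement≤n : ∀ g → agreement f g ≤ n
    agreement≤n g = ≤-trans (sum-mono λ w → χ≤1 (f w ≟ g w))
      (≤-reflexive (sum-ones n))
    -- `k` is fuel: each rotation raises the agreement, so `n < k + agreement f g` persists, and at
    -- zero it contradicts `agreement≤n`.
    go : ∀ k g → Maximum g → g t ≡ t → n < k + agreement f g → MissBoth u t ⊎ MissBoth t v
    go zero    g _     _  n< = contradiction (agreement≤n g) (<⇒≱ n<)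
    go (suc k) g g-max gt n< with g u ≟ u | g v ≟ v
    ... | yes gu | _      = inj₁ (g , g-max , gu , gt)
    ... | no _   | yes gv = inj₂ (g , g-max , gt , gv)
    ... | no gu  | no gv  with matched-by-first {t = t} f-max g-max u≢v fu fv gu gv
    ... | x , x≢t , gx , fx with g (f x) ≟ f x
    -- The edge of `f` at `x` cannot have both ends missed by the maximum matching `g`. So `g`
    -- matches `f x`, and it can be rotated to contain this edge; `t` stays missed as `x ≢ t`.
    ... | yes gfx = contradiction (adjacent F x fx)
                      (missed-nonadjacent (g , g-max , gx , gfx) (matched∉ F fx) (matched∉ F (partner-matched F fx)))
    ... | no gfx  = go k rotate rotate-maximum (rotate-missed gt (x≢t ∘ sym))
                      (≤-trans n< (≤-trans (≤-reflexive (sym (+-suc k _)))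
                        (+-monoʳ-≤ k (rotate-agreement {f} (involutive F) refl))))
      where open Rotation g-max gx gfx (matched∉ F fx) (adjacent F x fx)

-- Removing the essential vertices

record Barrier (G : Graph n) (d : ℕ) : Set₁ where
  field
    S     : Pred (Fin n) 0ℓ
    S?    : Decidable S
    s     : ℕ
    ∣S∣≤s : count S? ≤ s
    r     : ℕ
    -- For empty `S` this is the deficiency `d`. Each vertex moved into `S` adds 2: one for itself,
    -- now counted as unmatched, and one for the partner it leaves behind.
    d+2s≤r : d + 2 * s ≤ r
    r-min : ∀ f → IsMatching G S f → r ≤ unmatched f
  open MaximumMatchings G S? r r-min public
  field
    M           : Fin n → Fin n
    M-maximum   : Maximum M
    inessential : ∀ v → MissBoth v v

-- Descent from the empty matching: existence of a strictly better matching is decidable, and `k`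
-- bounds the number of vertices still unmatched.
minimal-unmatched : (G : Graph n) {S : Pred (Fin n) 0ℓ} (S? : Decidable S) →
  ∃[ M ] (IsMatching G S M × (∀ f → IsMatching G S f → unmatched M ≤ unmatched f))
minimal-unmatched {n} G {S} S? = go _ id empty ≤-refl
  where
  empty : IsMatching G S id
  empty = record { involutive = λ _ → refl ; adjacent = λ _ ne → contradiction refl ne ; avoids = λ _ _ → refl }
  go : ∀ k M → IsMatching G S M → unmatched M ≤ k → _
  better? : ∀ b → Dec (∃[ f ] (IsMatching G S f × unmatched f < b))
  better? b = ∃-function? (λ f → isMatching? G S? f ×-dec unmatched f <? b)
    (λ f≗g (F , lt) → isMatching-resp f≗g F , subst (_< b) (unmatched-resp f≗g) lt)
  go k M M-matching M≤k with better? (unmatched M)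
  ... | no none = M , M-matching , λ f F → ≮⇒≥ (λ lt → none (f , F , lt))
  go zero    M _ M≤k | yes (f , F , lt) = contradiction (≤-trans lt M≤k) λ ()
  go (suc k) M _ M≤k | yes (f , F , lt) = go k f F (ℕ.≤-pred (≤-trans lt M≤k))

-- A vertex covered by every maximum matching of G − S is moved into S: the
-- least number of unmatched vertices (S included) then grows by 2, by parity.
barrier : (G : Graph n) (d : ℕ) →
          (∀ f → IsMatching G (λ _ → ⊥) f → d ≤ unmatched f) → Barrier G d
barrier {n} G d deficient = go (suc n) (λ _ → ⊥) (λ _ → no λ ()) 0
  (≤-reflexive (count-none {n} {P = λ _ → ⊥} (λ _ → no λ ()) λ _ ()))
  (λ f F → ≤-trans (≤-reflexive (+-identityʳ d)) (deficient f F)) (m≤m+n (suc n) 0)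
  where
  -- Both sides will be `n`, so `a` and `b` have the same parity and a strict inequality leaves a
  -- gap of at least 2.
  parity : ∀ {a b c c′} → a + 2 * c ≡ b + 2 * c′ → a < b → 2 + a ≤ b
  parity {a} {b} {c} {c′} e a<b = +-cancelʳ-≤ (2 * c′) _ _ (begin
    2 + a + 2 * c′   ≡⟨ solve 2 (λ x y → con 2 :+ x :+ con 2 :* y := x :+ con 2 :* (con 1 :+ y)) refl a c′ ⟩
    a + 2 * (suc c′) ≤⟨ +-monoʳ-≤ a (*-monoʳ-≤ 2 c′<c) ⟩
    a + 2 * c        ≡⟨ e ⟩
    b + 2 * c′       ∎)
    where
    open ≤-Reasoning
    open +-*-Solver
    c′<c : c′ < c
    c′<c = ℕ.*-cancelˡ-< 2 c′ c (ℕ.+-cancelˡ-< a _ _ (ℕ.<-≤-trans (ℕ.+-monoˡ-< (2 * c′) a<b) (≤-reflexive (sym e))))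
  -- `k` is fuel again: `s` grows at each step, yet `d + 2 * s` never exceeds the number of
  -- vertices, so `n < k + s` forbids running out.
  go : ∀ k (S : Pred (Fin n) 0ℓ) (S? : Decidable S) s → count S? ≤ s →
       (∀ f → IsMatching G S f → d + 2 * s ≤ unmatched f) → n < k + s → Barrier G d
  go k S S? s ∣S∣≤s deficient n< with minimal-unmatched G S?
  ... | M , M-matching , M-min with all? (λ v → MaximumMatchings.missBoth? G S? (unmatched M) M-min v v)
  ... | yes all = record
    { S = S ; S? = S? ; s = s ; ∣S∣≤s = ∣S∣≤s ; r = unmatched M ; d+2s≤r = deficient M M-matching
    ; r-min = M-min ; M = M ; M-maximum = M-matching , refl ; inessential = all }
  ... | no ¬all with k | ¬∀⟶∃¬ n _ (λ v → MaximumMatchings.missBoth? G S? (unmatched M) M-min v v) ¬all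
  ... | zero   | _ = contradiction (≤-trans (m≤m+n s _) (≤-trans (m≤n+m _ d)
          (≤-trans (deficient M M-matching) unmatched≤n))) (<⇒≱ n<)
    where
    unmatched≤n : unmatched M ≤ n
    unmatched≤n = ≤-trans (m≤m+n _ _) (≤-reflexive (unmatched+moved M (involutive M-matching)))
  ... | suc k′ | v , essential = go k′ (λ w → w ≡ v ⊎ S w) (λ w → w ≟ v ⊎-dec S? w) (suc s)
    (begin
      count (λ w → w ≟ v ⊎-dec S? w)      ≤⟨ sum-mono (λ w → χ-⊎ (w ≟ v) (S? w) (w ≟ v ⊎-dec S? w) id) ⟩
      sum (λ w → χ (w ≟ v) + χ (S? w))    ≡⟨ ∑-distrib-+ (λ w → χ (w ≟ v)) (λ w → χ (S? w)) ⟩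
      count (_≟ v) + count S?             ≤⟨ +-mono-≤ (≤-reflexive (count-≡ v)) ∣S∣≤s ⟩
      suc s                               ∎)
    deficient′
    (ℕ.<-≤-trans n< (≤-reflexive (sym (+-suc k′ s))))
    where
    open ≤-Reasoning
    -- A matching avoiding `v` as well is a matching of the old G - S that misses `v`. It is not
    -- maximum, since `v` is essential.
    deficient′ : ∀ f → IsMatching G (λ w → w ≡ v ⊎ S w) f → d + 2 * suc s ≤ unmatched f
    deficient′ f F = begin
      d + 2 * suc s     ≡⟨ solve 2 (λ x y → x :+ con 2 :* (con 1 :+ y) := con 2 :+ (x :+ con 2 :* y)) refl d s ⟩
      2 + (d + 2 * s)   ≤⟨ +-monoʳ-≤ 2 (deficient M M-matching) ⟩
      2 + unmatched M   ≤⟨ parity {c = count (λ w → yes tt ×-dec w Fin.<? M w)} {count (λ w → yes tt ×-dec w Fin.<? f w)}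
                             (trans (unmatched+moved M (involutive M-matching)) (sym (unmatched+moved f (involutive F))))
                             (ℕ.≤∧≢⇒< (M-min f F′) λ e → essential (f , (F′ , sym e) , avoids F v (inj₁ refl) , avoids F v (inj₁ refl))) ⟩
      unmatched f       ∎
      where
      open +-*-Solver
      F′ : IsMatching G S f
      F′ = record { involutive = involutive F ; adjacent = adjacent F ; avoids = λ w Sw → avoids F w (inj₂ Sw) }

-- Classes of vertices missed by a maximum matching

module Classes {G : Graph n} {d : ℕ} (B : Barrier G d) where
  open Barrier B
  private
    F = proj₁ M-maximum

  Exposed : Pred (Fin n) 0ℓ
  Exposed u = ¬ S u × M u ≡ u

  exposed? : Decidable Exposed
  exposed? u = ¬? (S? u) ×-dec M u ≟ u

  -- In terms of the Gallai–Edmonds decomposition, this is the component of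
  -- G − S containing the exposed vertex u.
  Class : Fin n → Pred (Fin n) 0ℓ
  Class u w = Exposed u × ¬ S w × (w ≡ u ⊎ ¬ MissBoth u w)

  class? : ∀ u → Decidable (Class u)
  class? u w = exposed? u ×-dec ¬? (S? w) ×-dec (w ≟ u ⊎-dec ¬? (missBoth? u w))

  -- `M` misses both `u` and `v`. By Gallai's lemma some maximum matching then misses `w` together
  -- with one of them, so `w` cannot be in both classes.
  class-disjoint : ∀ {w u v} → Class u w → Class v w → u ≡ v
  class-disjoint {w} {u} {v} ((_ , Mu) , _ , wu) ((_ , Mv) , _ , wv) with u ≟ v
  ... | yes u≡v = u≡v
  ... | no u≢v  = disjoint wu wv
    where
    missed : MissBoth u v
    missed = M , M-maximum , Mu , Mv
    disjoint : w ≡ u ⊎ ¬ MissBoth u w → w ≡ v ⊎ ¬ MissBoth v w → u ≡ v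
    disjoint (inj₁ refl) (inj₁ refl) = refl
    disjoint (inj₁ refl) (inj₂ ¬vw)  = contradiction (missBoth-sym missed) ¬vw
    disjoint (inj₂ ¬uw)  (inj₁ refl) = contradiction missed ¬uw
    disjoint (inj₂ ¬uw)  (inj₂ ¬vw)  with gallai u≢v missed (inessential w)
    ... | inj₁ uw = contradiction uw ¬uw
    ... | inj₂ wv = contradiction (missBoth-sym wv) ¬vw

  -- Adjacent vertices outside `S` are never missed together, so they are related, and transitivity
  -- from Gallai's lemma carries `u` along the edge.
  class-closed : ∀ {u w x} → Class u w → Adj G w x → ¬ S x → Class u x
  class-closed {u} {w} {x} (exposed , w∉ , wu) wx x∉ with x ≟ u
  ... | yes x≡u = exposed , x∉ , inj₁ x≡u
  ... | no x≢u  = exposed , x∉ , inj₂ (λ ux → apart ux wu)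
    where
    apart : MissBoth u x → ¬ (w ≡ u ⊎ ¬ MissBoth u w)
    apart ux (inj₁ refl) = missed-nonadjacent ux w∉ x∉ wx
    apart ux (inj₂ ¬uw) with gallai (x≢u ∘ sym) ux (inessential w)
    ... | inj₁ uw  = ¬uw uw
    ... | inj₂ wx′ = missed-nonadjacent wx′ w∉ x∉ wx

  class-partner : ∀ {u w} → Class u w → Class u (M w)
  class-partner {u} {w} c with M w ≟ w
  ... | yes Mw = subst (Class u) (sym Mw) c
  ... | no Mw  = class-closed c (adjacent F w Mw) (matched∉ F (partner-matched F Mw))

  -- `u` is the only member that `M` misses, and `M` pairs up the others inside the class.
  class-odd : ∀ {u} → Exposed u → ∃[ j ] count (class? u) ≡ suc (2 * j)
  class-odd {u} exposed@(u∉ , Mu) = count (λ w → class? u w ×-dec w Fin.<? M w) , (begin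
    count (class? u)
      ≡⟨ sum-cong-≗ split ⟩
    sum (λ w → χ (w ≟ u) + χ (class? u w ×-dec ¬? (M w ≟ w)))
      ≡⟨ ∑-distrib-+ (λ w → χ (w ≟ u)) (λ w → χ (class? u w ×-dec ¬? (M w ≟ w))) ⟩
    count (_≟ u) + count (λ w → class? u w ×-dec ¬? (M w ≟ w))
      ≡⟨ cong₂ _+_ (count-≡ u) (count-moved M (involutive F) (class? u) class-partner) ⟩
    suc (2 * count (λ w → class? u w ×-dec w Fin.<? M w)) ∎)
    where
    open ≡-Reasoning
    cases : ∀ {w} → Class u w → w ≡ u ⊎ (Class u w × M w ≢ w)
    cases (_ , _ , inj₁ w≡u)   = inj₁ w≡u
    cases c@(_ , _ , inj₂ ¬uw) = inj₂ (c , λ Mw → ¬uw (M , M-maximum , Mu , Mw))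
    split : ∀ w → χ (class? u w) ≡ χ (w ≟ u) + χ (class? u w ×-dec ¬? (M w ≟ w))
    split w = trans
      (χ-cong (class? u w) (w ≟ u ⊎-dec (class? u w ×-dec ¬? (M w ≟ w)))
        cases (λ { (inj₁ refl) → exposed , u∉ , inj₁ refl ; (inj₂ (c , _)) → c }))
      (χ-disjoint-⊎ (w ≟ u) (class? u w ×-dec ¬? (M w ≟ w)) λ { (refl , _ , moved) → moved Mu })

  -- Of the `r` vertices missed by `M` at most `s` are in `S`; the rest are exposed.
  exposed-many : d + s ≤ count exposed?
  exposed-many = +-cancelʳ-≤ s _ _ (begin
    d + s + s                                ≡⟨ solve 2 (λ x y → x :+ y :+ y := x :+ con 2 :* y) refl d s ⟩
    d + 2 * s                                ≤⟨ d+2s≤r ⟩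
    r                                        ≡⟨ proj₂ M-maximum ⟨
    unmatched M                              ≤⟨ sum-mono (λ w → χ-⊎ (exposed? w) (S? w) (M w ≟ w) (cases w)) ⟩
    sum (λ w → χ (exposed? w) + χ (S? w))    ≡⟨ ∑-distrib-+ (λ w → χ (exposed? w)) (λ w → χ (S? w)) ⟩
    count exposed? + count S?                ≤⟨ +-monoʳ-≤ (count exposed?) ∣S∣≤s ⟩
    count exposed? + s                       ∎)
    where
    open ≤-Reasoning
    open +-*-Solver
    cases : ∀ w → M w ≡ w → Exposed w ⊎ S w
    cases w Mw with S? w
    ... | yes Sw = inj₂ Sw
    ... | no w∉  = inj₁ (w∉ , Mw)

  -- Disjointness of the classes in weighted form: weight 1 will count vertices, and weight
  -- `S-degree` will count edges into `S`.
  class-packing : (g : Fin n → ℕ) → sum (λ u → sum (λ w → χ (class? u w) * g w)) ≤ sum g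
  class-packing g = begin
    sum (λ u → sum (λ w → χ (class? u w) * g w))  ≡⟨ ∑-comm (λ u w → χ (class? u w) * g w) ⟩
    sum (λ w → sum (λ u → χ (class? u w) * g w))  ≡⟨ sum-cong-≗ (λ w → *-distribʳ-sum (g w) (λ u → χ (class? u w))) ⟨
    sum (λ w → count (λ u → class? u w) * g w)    ≤⟨ sum-mono (λ w → *-monoˡ-≤ (g w) (count-unique≤1 (λ u → class? u w) class-disjoint)) ⟩
    sum (λ w → 1 * g w)                           ≡⟨ sum-cong-≗ (λ w → *-identityˡ (g w)) ⟩
    sum g                                         ∎
    where open ≤-Reasoning

  -- Regular graphs: edges between the classes and S

  module Regular {k : ℕ} (regular : ∀ v → degree G v ≡ k) where

    S-degree : Fin n → ℕ
    S-degree w = count (λ x → S? x ×-dec Adj? G w x)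

    boundary : Fin n → ℕ
    boundary u = sum (λ w → χ (class? u w) * S-degree w)

    -- The adjacencies into `S` are counted from their ends in `S`: at most `s` vertices, each of
    -- degree `k`.
    sum-S-degree : sum S-degree ≤ s * k
    sum-S-degree = begin
      sum (λ w → sum (λ x → χ (S? x ×-dec Adj? G w x)))  ≡⟨ ∑-comm (λ w x → χ (S? x ×-dec Adj? G w x)) ⟩
      sum (λ x → sum (λ w → χ (S? x ×-dec Adj? G w x)))  ≡⟨ sum-cong-≗ from-S ⟩
      sum (λ x → χ (S? x) * count (Adj? G x))            ≡⟨ sum-cong-≗ (λ x → cong (χ (S? x) *_) (trans (sym (degree-sum G x)) (regular x))) ⟩
      sum (λ x → χ (S? x) * k)                           ≡⟨ *-distribʳ-sum k (λ x → χ (S? x)) ⟨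
      count S? * k                                       ≤⟨ *-monoˡ-≤ k ∣S∣≤s ⟩
      s * k                                              ∎
      where
      open ≤-Reasoning
      from-S : ∀ x → sum (λ w → χ (S? x ×-dec Adj? G w x)) ≡ χ (S? x) * count (Adj? G x)
      from-S x = trans
        (sum-cong-≗ λ w → trans (χ-×-* (S? x) (Adj? G w x))
          (cong (χ (S? x) *_) (χ-cong (Adj? G w x) (Adj? G x w) (symm G) (symm G))))
        (sym (*-distribˡ-sum (χ (S? x)) (λ w → χ (Adj? G x w))))

    -- The `k + 1` vertices made up of `w` and its neighbours all lie in the class or in `S`, by
    -- `class-closed`.
    class-degree : ∀ {u w} → Class u w → suc k ≤ count (class? u) + S-degree w
    class-degree {u} {w} c = begin
      suc k
        ≡⟨ cong₂ _+_ (count-≡ w) (trans (sym (degree-sum G w)) (regular w)) ⟨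
      count (_≟ w) + count (Adj? G w)
        ≡⟨ ∑-distrib-+ (λ x → χ (x ≟ w)) (λ x → χ (Adj? G w x)) ⟨
      sum (λ x → χ (x ≟ w) + χ (Adj? G w x))
        ≤⟨ sum-mono (λ x → ≤-trans
             (≤-reflexive (sym (χ-disjoint-⊎ (x ≟ w) (Adj? G w x) λ (e , wx) → irrefl G (sym e) wx)))
             (χ-⊎ (class? u x) (S? x ×-dec Adj? G w x) (x ≟ w ⊎-dec Adj? G w x) (cases x))) ⟩
      sum (λ x → χ (class? u x) + χ (S? x ×-dec Adj? G w x))
        ≡⟨ ∑-distrib-+ (λ x → χ (class? u x)) (λ x → χ (S? x ×-dec Adj? G w x)) ⟩
      count (class? u) + S-degree w ∎
      where
      open ≤-Reasoning
      cases : ∀ x → x ≡ w ⊎ Adj G w x → Class u x ⊎ (S x × Adj G w x)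
      cases x (inj₁ refl) = inj₁ c
      cases x (inj₂ wx) with S? x
      ... | yes Sx = inj₂ (Sx , wx)
      ... | no x∉  = inj₁ (class-closed c wx x∉)

    class-boundary : ∀ u → count (class? u) * suc k ≤ count (class? u) * count (class? u) + boundary u
    class-boundary u = begin
      c * suc k
        ≡⟨ *-distribʳ-sum (suc k) (λ w → χ (class? u w)) ⟩
      sum (λ w → χ (class? u w) * suc k)
        ≤⟨ sum-mono (λ w → pointwise w (class? u w)) ⟩
      sum (λ w → χ (class? u w) * c + χ (class? u w) * S-degree w)
        ≡⟨ ∑-distrib-+ (λ w → χ (class? u w) * c) (λ w → χ (class? u w) * S-degree w) ⟩
      sum (λ w → χ (class? u w) * c) + boundary u
        ≡⟨ cong (_+ boundary u) (*-distribʳ-sum c (λ w → χ (class? u w))) ⟨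
      c * c + boundary u ∎
      where
      open ≤-Reasoning
      c = count (class? u)
      pointwise : ∀ w (C? : Dec (Class u w)) → χ C? * suc k ≤ χ C? * c + χ C? * S-degree w
      pointwise w (no _)  = z≤n
      pointwise w (yes p) = ≤-trans (*-monoʳ-≤ 1 (class-degree p)) (≤-reflexive (*-distribˡ-+ 1 c (S-degree w)))

    -- c vertices of degree k span at most c(c − 1)/2 edges among themselves,
    -- and c(k + 1 − c) ≥ k for 1 ≤ c ≤ k.
    small-class : ∀ {u} → Exposed u → count (class? u) ≤ k → k ≤ boundary u
    small-class {u} exposed c≤k with count (class? u) | class-odd exposed | class-boundary u | m≤n⇒∃[o]m+o≡n c≤k
    ... | .(suc (2 * j)) | j , refl | bound | g , refl = +-cancelˡ-≤ (c * c) _ _ (begin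
      -- Here `k` is `c + g`, and `c` being `suc (2 * j)` gives `c * g` the summand `g`.
      c * c + (c + g)          ≤⟨ +-monoʳ-≤ (c * c) (+-monoʳ-≤ c (m≤m+n g (2 * j * g))) ⟩
      c * c + (c + c * g)      ≡⟨ solve 2 (λ x y → x :* x :+ (x :+ x :* y) := x :* (con 1 :+ (x :+ y))) refl c g ⟩
      c * suc (c + g)          ≤⟨ bound ⟩
      c * c + boundary u       ∎)
      where
      open ≤-Reasoning
      open +-*-Solver
      c = suc (2 * j)

    -- An odd class with fewer than `2 * t + 3` vertices has at most `2 * t + 1 ≤ k`, so
    -- `small-class` applies to it. Counting edges into `S` leaves at most `s` such classes, hence
    -- at least `d` disjoint big ones.
    order-bound : ∀ t → 2 * t < k → d * (2 * t + 3) ≤ n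
    order-bound t 2t<k = begin
      d * (2 * t + 3)                       ≤⟨ *-monoˡ-≤ (2 * t + 3) d≤big ⟩
      count big? * (2 * t + 3)              ≡⟨ *-distribʳ-sum (2 * t + 3) (λ u → χ (big? u)) ⟩
      sum (λ u → χ (big? u) * (2 * t + 3))  ≤⟨ sum-mono (λ u → weight (big? u) proj₂) ⟩
      sum (λ u → count (class? u))          ≡⟨ sum-cong-≗ (λ u → sum-cong-≗ λ w → *-identityʳ (χ (class? u w))) ⟨
      sum (λ u → sum (λ w → χ (class? u w) * 1)) ≤⟨ class-packing (λ _ → 1) ⟩
      sum {n} (λ _ → 1)                     ≡⟨ sum-ones n ⟩
      n                                     ∎
      where
      open ≤-Reasoning
      Big Small : Pred (Fin n) 0ℓ
      Big   u = Exposed u × 2 * t + 3 ≤ count (class? u)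
      Small u = Exposed u × ¬ 2 * t + 3 ≤ count (class? u)
      big? : Decidable Big
      big? u = exposed? u ×-dec 2 * t + 3 ≤? count (class? u)
      small? : Decidable Small
      small? u = exposed? u ×-dec ¬? (2 * t + 3 ≤? count (class? u))
      weight : ∀ {A : Set} (A? : Dec A) {x y} → (A → x ≤ y) → χ A? * x ≤ y
      weight (yes a) {x} x≤y = ≤-trans (≤-reflexive (*-identityˡ x)) (x≤y a)
      weight (no _)  _   = z≤n
      small-boundary : ∀ {u} → Small u → k ≤ boundary u
      small-boundary {u} (exposed , c≱) = small-class exposed (≤-trans c≤ 2t<k)
        where
        c≤ : count (class? u) ≤ suc (2 * t)
        c≤ with class-odd exposed
        ... | j , c≡ = ≤-trans (≤-reflexive c≡) (s≤s (*-monoʳ-≤ 2 {j} {t} (≮⇒≥ λ t<j → c≱ (begin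
          2 * t + 3         ≡⟨ solve 1 (λ x → con 2 :* x :+ con 3 := con 1 :+ con 2 :* (con 1 :+ x)) refl t ⟩
          suc (2 * suc t)   ≤⟨ s≤s (*-monoʳ-≤ 2 t<j) ⟩
          suc (2 * j)       ≡⟨ c≡ ⟨
          count (class? u)  ∎))))
          where open +-*-Solver
      small≤s : count small? ≤ s
      small≤s = *-cancelʳ-≤ (count small?) s k {{>-nonZero (ℕ.≤-<-trans z≤n 2t<k)}} (begin
        count small? * k                 ≡⟨ *-distribʳ-sum k (λ u → χ (small? u)) ⟩
        sum (λ u → χ (small? u) * k)     ≤⟨ sum-mono (λ u → weight (small? u) small-boundary) ⟩
        sum boundary                     ≤⟨ class-packing S-degree ⟩
        sum S-degree                     ≤⟨ sum-S-degree ⟩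
        s * k                            ∎)
      cases : ∀ u → Exposed u → Big u ⊎ Small u
      cases u exposed with 2 * t + 3 ≤? count (class? u)
      ... | yes big = inj₁ (exposed , big)
      ... | no small = inj₂ (exposed , small)
      d≤big : d ≤ count big?
      d≤big = +-cancelʳ-≤ s _ _ (begin
        d + s                                    ≤⟨ exposed-many ⟩
        count exposed?                           ≤⟨ sum-mono (λ u → χ-⊎ (big? u) (small? u) (exposed? u) (cases u)) ⟩
        sum (λ u → χ (big? u) + χ (small? u))    ≡⟨ ∑-distrib-+ (λ u → χ (big? u)) (λ u → χ (small? u)) ⟩
        count big? + count small?                ≤⟨ +-monoʳ-≤ (count big?) small≤s ⟩
        count big? + s                           ∎)

-- Unions of odd circulants

count-< : ∀ n t → t ≤ n → count {n} (λ x → toℕ x <? t) ≡ t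
count-< n       zero    _         = count-none {n} (λ x → toℕ x <? 0) λ _ ()
count-< (suc n) (suc t) (s≤s t≤n) = cong suc (trans
  (sum-cong-≗ {n} λ x → χ-cong (suc (toℕ x) <? suc t) (toℕ x <? t) ℕ.≤-pred s≤s) (count-< n t t≤n))

count-≥ : ∀ n t → t ≤ n → count {n} (λ x → n ≤? toℕ x + t) ≡ t
count-≥ n t t≤n = ℕ.+-cancelˡ-≡ (n ∸ t) _ _ (begin
  (n ∸ t) + count {n} (λ x → n ≤? toℕ x + t)
    ≡⟨ cong (_+ count {n} (λ x → n ≤? toℕ x + t)) (count-< n (n ∸ t) (ℕ.m∸n≤m n t)) ⟨
  count {n} (λ x → toℕ x <? n ∸ t) + count {n} (λ x → n ≤? toℕ x + t)
    ≡⟨ ∑-distrib-+ {n} (λ x → χ (toℕ x <? n ∸ t)) (λ x → χ (n ≤? toℕ x + t)) ⟨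
  sum {n} (λ x → χ (toℕ x <? n ∸ t) + χ (n ≤? toℕ x + t))
    ≡⟨ sum-cong-≗ {n} (λ x → one (toℕ x)) ⟩
  sum {n} (λ _ → 1)
    ≡⟨ sum-ones n ⟩
  n
    ≡⟨ ℕ.m∸n+n≡m t≤n ⟨
  (n ∸ t) + t ∎)
  where
  open ≡-Reasoning
  one : ∀ x → χ (x <? n ∸ t) + χ (n ≤? x + t) ≡ 1
  one x with n ≤? x + t
  ... | yes n≤ = cong₂ _+_
    (χ-no (x <? n ∸ t) λ x< → <⇒≱ x< (≤-trans (ℕ.∸-monoˡ-≤ t n≤) (≤-reflexive (ℕ.m+n∸n≡m x t))))
    (χ-yes (n ≤? x + t) n≤)
  ... | no n≰  = cong₂ _+_
    (χ-yes (x <? n ∸ t) (ℕ.m+n≤o⇒m≤o∸n (suc x) (≰⇒> n≰))) (χ-no (n ≤? x + t) n≰)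

sum-pairs : ∀ k (f : Fin (k * 2) → ℕ) →
            sum f ≡ sum {k} (λ i → f (combine i zero) + f (combine i (suc zero)))
sum-pairs zero    f = refl
sum-pairs (suc k) f = trans (sym (+-assoc (f zero) _ _))
  (cong (f zero + f (suc zero) +_) (sum-pairs k (λ x → f (suc (suc x)))))

-- Passing from i to i + 1 drops the term at the last j and adds one at the first.
sum-cyclic : ∀ n (c : ℕ → ℕ) → (∀ x → x < n → c (suc x) ≡ c (n ∸ x)) →
             ∀ i → i ≤ n → sum {suc n} (λ j → c ∣ i - toℕ j ∣) ≡ sum {suc n} (c ∘ toℕ)
sum-cyclic n c c-sym zero    _   = refl
sum-cyclic n c c-sym (suc i) i<n = begin
  c (suc i) + sum {n} (λ j → c ∣ i - toℕ j ∣)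
    ≡⟨ cong₂ _+_ (trans (c-sym i i<n) (cong c (sym last))) (sum-cong-≗ {n} λ j → cong (λ x → c ∣ i - x ∣) (sym (toℕ-inject₁ j))) ⟩
  c ∣ i - toℕ (fromℕ n) ∣ + sum {n} (λ j → c ∣ i - toℕ (inject₁ j) ∣)
    ≡⟨ +-comm (c ∣ i - toℕ (fromℕ n) ∣) _ ⟩
  sum {n} (λ j → c ∣ i - toℕ (inject₁ j) ∣) + c ∣ i - toℕ (fromℕ n) ∣
    ≡⟨ sum-init-last {n} (λ j → c ∣ i - toℕ j ∣) ⟨
  sum {suc n} (λ j → c ∣ i - toℕ j ∣)
    ≡⟨ sum-cyclic n c c-sym i (ℕ.<⇒≤ i<n) ⟩
  sum {suc n} (c ∘ toℕ) ∎
  where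
  open ≡-Reasoning
  last : ∣ i - toℕ (fromℕ n) ∣ ≡ n ∸ i
  last = trans (cong (∣ i -_∣) (toℕ-fromℕ n)) (ℕ.m≤n⇒∣m-n∣≡n∸m (ℕ.<⇒≤ i<n))

-- For labels at difference `δ`, this says that their distance on the cycle of length `n` is between
-- 1 and `t`. The condition `n ∸ δ ≤ t` is written without subtraction.
Near : (n t δ : ℕ) → Set
Near n t δ = 0 < δ × (δ ≤ t ⊎ n ≤ δ + t)

near? : ∀ n t δ → Dec (Near n t δ)
near? n t δ = 0 <? δ ×-dec (δ ≤? t ⊎-dec n ≤? δ + t)

circulant : (n t : ℕ) → Graph n
circulant n t = record
  { Adj    = λ i j → Near n t ∣ toℕ i - toℕ j ∣
  ; Adj?   = λ i j → near? n t ∣ toℕ i - toℕ j ∣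
  ; symm   = λ {i} {j} → subst (Near n t) (ℕ.∣-∣-comm (toℕ i) (toℕ j))
  ; irrefl = λ { {i} refl (0<δ , _) → ℕ.<-irrefl (sym (ℕ.∣n-n∣≡0 (toℕ i))) 0<δ }
  }

-- Going round the cycle the other way replaces the difference `suc x` by `suc n ∸ suc x` and
-- exchanges the two alternatives of `Near`.
near-sym : ∀ {n t x} → x < n → Near (suc n) t (suc x) → Near (suc n) t (n ∸ x)
near-sym {n} {t} {x} x<n (_ , inj₁ x<t) = ℕ.m<n⇒0<n∸m x<n , inj₂ (begin
  suc n             ≡⟨ cong suc (ℕ.m∸n+n≡m (ℕ.<⇒≤ x<n)) ⟨
  suc (n ∸ x + x)   ≡⟨ +-suc (n ∸ x) x ⟨
  n ∸ x + suc x     ≤⟨ +-monoʳ-≤ (n ∸ x) x<t ⟩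
  n ∸ x + t         ∎)
  where open ≤-Reasoning
near-sym {n} {t} {x} x<n (_ , inj₂ (s≤s n≤)) = ℕ.m<n⇒0<n∸m x<n , inj₁ (ℕ.m≤n+o⇒m∸n≤o n x n≤)

-- By `sum-cyclic` every vertex has the degree of vertex 0, whose neighbours are the `t` smallest
-- and the `t` largest nonzero labels. These are disjoint since `2 * t ≤ n`.
circulant-regular : ∀ n t → 2 * t ≤ n → ∀ v → degree (circulant (suc n) t) v ≡ 2 * t
circulant-regular n t 2t≤n v = begin
  degree (circulant (suc n) t) v
    ≡⟨ degree-sum (circulant (suc n) t) v ⟩
  sum {suc n} (λ j → c ∣ toℕ v - toℕ j ∣)
    ≡⟨ sum-cyclic n c c-sym (toℕ v) (ℕ.≤-pred (toℕ<n v)) ⟩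
  sum {n} (λ x → c (suc (toℕ x)))
    ≡⟨ sum-cong-≗ {n} (λ x → split (toℕ x)) ⟩
  sum {n} (λ x → χ (toℕ x <? t) + χ (n ≤? toℕ x + t))
    ≡⟨ ∑-distrib-+ {n} (λ x → χ (toℕ x <? t)) (λ x → χ (n ≤? toℕ x + t)) ⟩
  count {n} (λ x → toℕ x <? t) + count {n} (λ x → n ≤? toℕ x + t)
    ≡⟨ cong₂ _+_ (count-< n t t≤n) (count-≥ n t t≤n) ⟩
  t + t
    ≡⟨ cong (t +_) (+-identityʳ t) ⟨
  2 * t ∎
  where
  open ≡-Reasoning
  t≤n : t ≤ n
  t≤n = ≤-trans (m≤m+n t _) 2t≤n
  c : ℕ → ℕ
  c δ = χ (near? (suc n) t δ)
  c-sym : ∀ x → x < n → c (suc x) ≡ c (n ∸ x)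
  -- The reflection is its own inverse, so the converse is `near-sym` at the reflected point `x′`.
  c-sym x x<n = χ-cong (near? (suc n) t (suc x)) (near? (suc n) t (n ∸ x)) (near-sym x<n)
    (subst (Near (suc n) t) reflected ∘ near-sym x′<n ∘ subst (Near (suc n) t) (sym suc-x′))
    where
    x′ = n ∸ suc x
    suc-x′ : suc x′ ≡ n ∸ x
    suc-x′ = sym (ℕ.+-∸-assoc 1 x<n)
    x′<n : x′ < n
    x′<n = ℕ.∸-monoʳ-< {n} z<s x<n
    reflected : n ∸ x′ ≡ suc x
    reflected = ℕ.m∸[m∸n]≡n x<n
  split : ∀ x → c (suc x) ≡ χ (x <? t) + χ (n ≤? x + t)
  split x = trans
    (χ-cong (near? (suc n) t (suc x)) (x <? t ⊎-dec n ≤? x + t)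
      (λ { (_ , inj₁ x<t) → inj₁ x<t ; (_ , inj₂ (s≤s n≤)) → inj₂ n≤ })
      (λ { (inj₁ x<t) → z<s , inj₁ x<t ; (inj₂ n≤) → z<s , inj₂ (s≤s n≤) }))
    (χ-disjoint-⊎ (x <? t) (n ≤? x + t)
      (λ (x<t , n≤) → <⇒≱ (ℕ.+-monoˡ-< t x<t) (≤-trans (≤-reflexive (cong (t +_) (sym (+-identityʳ t)))) (≤-trans 2t≤n n≤))))

infixr 5 _⊕_
_⊕_ : Graph m → Graph n → Graph (m + n)
_⊕_ {m} G H = record
  { Adj    = λ u v → Pointwise (Adj G) (Adj H) (splitAt m u) (splitAt m v)
  ; Adj?   = λ u v → ⊎-decidable (Adj? G) (Adj? H) (splitAt m u) (splitAt m v)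
  ; symm   = ⊎-symmetric (symm G) (symm H)
  ; irrefl = λ { {u} refl → irreflexive (splitAt m u) }
  }
  where
  irreflexive : ∀ x → ¬ Pointwise (Adj G) (Adj H) x x
  irreflexive (inj₁ _) (inj₁ a) = irrefl G refl a
  irreflexive (inj₂ _) (inj₂ a) = irrefl H refl a

⊕-regular : ∀ {k} (G : Graph m) (H : Graph n) → (∀ v → degree G v ≡ k) → (∀ v → degree H v ≡ k) →
            ∀ v → degree (G ⊕ H) v ≡ k
⊕-regular {m} {n} {k} G H G-reg H-reg v = begin
  degree (G ⊕ H) v
    ≡⟨ degree-sum (G ⊕ H) v ⟩
  sum (λ u → χ (adj? (splitAt m v) (splitAt m u)))
    ≡⟨ sum-↑ m (λ u → χ (adj? (splitAt m v) (splitAt m u))) ⟩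
  sum (λ i → χ (adj? (splitAt m v) (splitAt m (i ↑ˡ n)))) + sum (λ j → χ (adj? (splitAt m v) (splitAt m (m ↑ʳ j))))
    ≡⟨ cong₂ _+_ (sum-cong-≗ λ i → cong (χ ∘ adj? (splitAt m v)) (splitAt-↑ˡ m i n))
                 (sum-cong-≗ λ j → cong (χ ∘ adj? (splitAt m v)) (splitAt-↑ʳ m n j)) ⟩
  sum (λ i → χ (adj? (splitAt m v) (inj₁ i))) + sum (λ j → χ (adj? (splitAt m v) (inj₂ j)))
    ≡⟨ side (splitAt m v) ⟩
  k ∎
  where
  open ≡-Reasoning
  adj? = ⊎-decidable (Adj? G) (Adj? H)
  side : ∀ x → sum (λ i → χ (adj? x (inj₁ i))) + sum (λ j → χ (adj? x (inj₂ j))) ≡ k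
  side (inj₁ x) = trans (cong₂ _+_
    (trans (sum-cong-≗ λ i → χ-cong (adj? (inj₁ x) (inj₁ i)) (Adj? G x i) drop-inj₁ inj₁)
           (trans (sym (degree-sum G x)) (G-reg x)))
    (count-none (λ j → adj? (inj₁ x) (inj₂ j)) λ _ ()))
    (+-identityʳ k)
  side (inj₂ y) = cong₂ _+_
    (count-none (λ i → adj? (inj₂ y) (inj₁ i)) λ _ ())
    (trans (sum-cong-≗ λ j → χ-cong (adj? (inj₂ y) (inj₂ j)) (Adj? H y j) drop-inj₂ inj₂)
           (trans (sym (degree-sum H y)) (H-reg y)))

-- A certificate that every matching leaves at least `d` vertices unmatched: an odd set with no
-- edges leaving it has no perfect matching.
record OddParts (n d k : ℕ) : Set₁ where
  field
    graph   : Graph n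
    regular : ∀ v → degree graph v ≡ k
    part    : Fin n → Fin d
    within  : ∀ {u v} → Adj graph u v → part u ≡ part v
    odd     : ∀ c → ∃[ j ] count (λ v → part v ≟ c) ≡ suc (2 * j)

-- The two ends of each embedded edge lie in the same part, so a copy uses an even number of
-- vertices of each odd part and leaves one over. This would need `d + 2 * suc m` vertices.
oddParts-free : ∀ {d k} (P : OddParts n d k) → n ≡ d + 2 * m → Free (copies (suc m) (K 2)) (OddParts.graph P)
oddParts-free {n} {m} {d} P n≡ (h , h-inj , h-edge) = <⇒≱ too-many (begin
  d + suc m * 2
    ≡⟨ cong₂ _+_ (sum-ones d) (count-partition (part ∘ h)) ⟨
  sum {d} (λ _ → 1) + sum (λ c → count (λ x → part (h x) ≟ c))
    ≡⟨ ∑-distrib-+ (λ _ → 1) (λ c → count (λ x → part (h x) ≟ c)) ⟨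
  sum (λ c → suc (count (λ x → part (h x) ≟ c)))
    ≤⟨ sum-mono not-perfect ⟩
  sum (λ c → count (λ v → part v ≟ c))
    ≡⟨ count-partition part ⟩
  n ∎)
  where
  open OddParts P
  open ≤-Reasoning
  too-many : n < d + suc m * 2
  too-many = begin-strict
    n                ≡⟨ n≡ ⟩
    d + 2 * m        <⟨ ℕ.+-monoʳ-< d (ℕ.*-monoʳ-< 2 (ℕ.n<1+n m)) ⟩
    d + 2 * suc m    ≡⟨ cong (d +_) (*-comm 2 (suc m)) ⟩
    d + suc m * 2    ∎
  pair : ∀ i → part (h (combine i zero)) ≡ part (h (combine i (suc zero)))
  pair i = within (h-edge (combine i zero) (combine i (suc zero))
    ( trans (cong proj₁ (remQuot-combine i (zero {1}))) (sym (cong proj₁ (remQuot-combine i (suc (zero {0})))))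
    , λ e → contradiction (trans (sym (cong proj₂ (remQuot-combine i (zero {1})))) (trans e (cong proj₂ (remQuot-combine i (suc (zero {0})))))) λ ()))
  even : ∀ c → count (λ x → part (h x) ≟ c) ≡ 2 * count {suc m} (λ i → part (h (combine i zero)) ≟ c)
  even c = trans (sum-pairs (suc m) (λ x → χ (part (h x) ≟ c))) (trans
    (sum-cong-≗ {suc m} λ i → cong (χ (part (h (combine i zero)) ≟ c) +_)
      (trans (cong (λ p → χ (p ≟ c)) (sym (pair i))) (sym (+-identityʳ _))))
    (sym (*-distribˡ-sum 2 (λ (i : Fin (suc m)) → χ (part (h (combine i zero)) ≟ c)))))
  not-perfect : ∀ c → count (λ x → part (h x) ≟ c) < count (λ v → part v ≟ c)
  not-perfect c with odd c
  ... | j , odd-c = ℕ.≤∧≢⇒< (count-injection (λ v → part v ≟ c) h (λ {x} {y} → h-inj {x} {y}))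
    λ e → ℕ.even≢odd (count {suc m} (λ i → part (h (combine i zero)) ≟ c)) j (trans (sym (even c)) (trans e odd-c))

-- Of the `i + 1` parts, `i` have the least order `2 * t + 1` that allows degree `2 * t`; the last
-- one absorbs the surplus `2 * s`, which keeps it odd.
oddParts : ∀ t s i → OddParts (i * suc (2 * t) + suc (2 * (t + s))) (suc i) (2 * t)
oddParts t s zero = record
  { graph   = circulant (suc (2 * (t + s))) t
  ; regular = circulant-regular (2 * (t + s)) t (*-monoʳ-≤ 2 (m≤m+n t s))
  ; part    = const zero
  ; within  = const refl
  ; odd     = λ { zero → t + s , sum-ones N }
  }
  where N = suc (2 * (t + s))
oddParts t s (suc i) = subst (λ n → OddParts n (suc (suc i)) (2 * t)) (sym (+-assoc N (i * N) _)) (record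
  { graph   = circulant N t ⊕ graph
  ; regular = ⊕-regular (circulant N t) graph (circulant-regular (2 * t) t ≤-refl) regular
  ; part    = [ const zero , suc ∘ part ]′ ∘ splitAt N
  ; within  = λ {u} {v} → same (splitAt N u) (splitAt N v)
  ; odd     = odd′
  })
  where
  N = suc (2 * t)
  open OddParts (oddParts t s i)
  rest = i * N + suc (2 * (t + s))
  part′ : Fin N ⊎ Fin rest → Fin (suc (suc i))
  part′ = [ const zero , suc ∘ part ]′
  same : ∀ x y → Pointwise (Adj (circulant N t)) (Adj graph) x y → part′ x ≡ part′ y
  same _ _ (inj₁ _) = refl
  same _ _ (inj₂ a) = cong suc (within a)
  size : ∀ c → count (λ v → part′ (splitAt N v) ≟ c) ≡
               count {N} (λ _ → zero ≟ c) + count (λ v → suc (part v) ≟ c)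
  size c = trans (sum-↑ N (λ v → χ (part′ (splitAt N v) ≟ c))) (cong₂ _+_
    (sum-cong-≗ λ x → cong (λ y → χ (part′ y ≟ c)) (splitAt-↑ˡ N x rest))
    (sum-cong-≗ λ x → cong (λ y → χ (part′ y ≟ c)) (splitAt-↑ʳ N rest x)))
  odd′ : ∀ c → ∃[ j ] count (λ v → part′ (splitAt N v) ≟ c) ≡ suc (2 * j)
  odd′ zero = t , trans (size zero) (trans (cong₂ _+_
    (sum-ones N) (count-none (λ v → suc (part v) ≟ zero) λ _ ())) (+-identityʳ N))
  odd′ (suc c) with odd c
  ... | j , odd-c = j , trans (size (suc c)) (cong₂ _+_
    (count-none {N} (λ _ → zero ≟ suc c) λ _ ())
    (trans (sum-cong-≗ λ v → χ-cong (suc (part v) ≟ suc c) (part v ≟ c) suc-injective (cong suc)) odd-c))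

-- The value of the regular Turán number

even-or-odd : ∀ q → ∃[ t ] (q ≡ 2 * t ⊎ q ≡ suc (2 * t))
even-or-odd zero = 0 , inj₁ refl
even-or-odd (suc q) with even-or-odd q
... | t , inj₁ q≡2t   = t , inj₂ (cong suc q≡2t)
... | t , inj₂ q≡2t+1 = suc t , inj₁ (trans (cong suc q≡2t+1) (sym (ℕ.*-suc 2 t)))

half : ∀ {e a} → 2 * e ≡ a → e ≡ a / 2
half {e} refl = trans (sym (m*n/n≡m e 2)) (cong (_/ 2) (*-comm e 2))

module _ (n m : ℕ) (2m+2≤n : 2 * m + 2 ≤ n) where

  private
    d = n ∸ 2 * m
    q = quot n m 2m+2≤n
    instance
      d-nonZero : NonZero d
      d-nonZero = n∸2m-nonZero n m 2m+2≤n
    2m≤n : 2 * m ≤ n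
    2m≤n = ≤-trans (m≤m+n (2 * m) 2) 2m+2≤n
    n≡d+2m : n ≡ d + 2 * m
    n≡d+2m = sym (ℕ.m∸n+n≡m 2m≤n)

  quot>0 : 0 < q
  quot>0 = m≥n⇒m/n>0 (ℕ.m∸n≤m n (2 * m))

  -- 2t is the largest even number below the quotient.
  isRex : ∀ t → suc (2 * t) ≤ q → q ≤ 2 + 2 * t → IsRex n (copies (suc m) (K 2)) (n * (2 * t) / 2)
  isRex t 2t<q q≤2t+2 = record
    { attained = graph , (2 * t , regular) , oddParts-free P n≡d+2m , half (regular-edgeCount graph regular)
    ; upperBound = upper
    }
    where
    open ≤-Reasoning
    td≤m : t * d ≤ m
    td≤m = *-cancelˡ-≤ 2 (+-cancelˡ-≤ d _ _ (begin
      d + 2 * (t * d)    ≡⟨ cong (d +_) (*-assoc 2 t d) ⟨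
      suc (2 * t) * d    ≤⟨ *-monoˡ-≤ d 2t<q ⟩
      q * d              ≤⟨ m/n*n≤m n d ⟩
      n                  ≡⟨ n≡d+2m ⟩
      d + 2 * m          ∎))
    P : OddParts n d (2 * t)
    -- With `d` as `i + 1` and `m` as `t * d + s`, the order `d + 2 * m` becomes that of
    -- `oddParts t s i`.
    P with d | n≡d+2m | td≤m | d-nonZero
    ... | suc i | n≡ | td≤m | _ with m≤n⇒∃[o]m+o≡n td≤m
    ... | s , m≡ = subst (λ x → OddParts x (suc i) (2 * t)) (sym order) (oddParts t s i)
      where
      open +-*-Solver
      order : n ≡ i * suc (2 * t) + suc (2 * (t + s))
      order = trans n≡ (trans (cong (λ x → suc i + 2 * x) (sym m≡))
        (solve 3 (λ i t s → con 1 :+ i :+ con 2 :* (t :* (con 1 :+ i) :+ s)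
                  := i :* (con 1 :+ con 2 :* t) :+ (con 1 :+ con 2 :* (t :+ s))) refl i t s))
    open OddParts P
    n<[1+q]d : n < suc q * d
    n<[1+q]d = begin-strict
      n                ≡⟨ m≡m%n+[m/n]*n n d ⟩
      n % d + q * d    <⟨ ℕ.+-monoˡ-< (q * d) (m%n<n n d) ⟩
      d + q * d        ∎
    upper : (G : Graph n) → Regular G → Free (copies (suc m) (K 2)) G → edgeCount G ≤ n * (2 * t) / 2
    upper G (k , k-regular) free = begin
      edgeCount G       ≡⟨ half (regular-edgeCount G k-regular) ⟩
      n * k / 2         ≤⟨ /-monoˡ-≤ 2 (*-monoʳ-≤ n (≮⇒≥ 2t≮k)) ⟩
      n * (2 * t) / 2   ∎
      where
      deficient : ∀ f → IsMatching G (λ _ → ⊥) f → d ≤ unmatched f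
      deficient f F = ℕ.m≤n+o⇒m∸n≤o n (2 * m)
        (≤-trans (free⇒unmatched G free f F) (≤-reflexive (+-comm (unmatched f) (2 * m))))
      -- A larger degree would force `d * (2 * t + 3) ≤ n`, whereas `q ≤ 2 + 2 * t` makes the left
      -- side at least `suc q * d`, which exceeds `n`.
      2t≮k : ¬ 2 * t < k
      2t≮k 2t<k = <⇒≱ n<[1+q]d (begin
        suc q * d              ≤⟨ *-monoˡ-≤ d (s≤s q≤2t+2) ⟩
        (3 + 2 * t) * d        ≡⟨ *-comm (3 + 2 * t) d ⟩
        d * (3 + 2 * t)        ≡⟨ cong (d *_) (+-comm 3 (2 * t)) ⟩
        d * (2 * t + 3)        ≤⟨ Classes.Regular.order-bound (barrier G d deficient) k-regular t 2t<k ⟩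
        n                      ∎)

theorem2 : (n m : ℕ) (h : 2 * m + 2 ≤ n) → 1 ≤ m →
    (¬ (2 ∣ quot n m h) → IsRex n (copies (suc m) (K 2)) ((n * (quot n m h ∸ 1)) / 2))
    × (2 ∣ quot n m h → IsRex n (copies (suc m) (K 2)) ((n * (quot n m h ∸ 2)) / 2))
theorem2 n m h _ = odd-case , even-case
  where
  q = quot n m h
  Rex : ℕ → Set₁
  Rex k = IsRex n (copies (suc m) (K 2)) (n * k / 2)
  odd-case : ¬ 2 ∣ q → Rex (q ∸ 1)
  odd-case 2∤q with even-or-odd q
  ... | t , inj₁ q≡2t   = contradiction (divides t (trans q≡2t (*-comm 2 t))) 2∤q
  ... | t , inj₂ q≡2t+1 = subst Rex (sym (cong (_∸ 1) q≡2t+1))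
    (isRex n m h t (≤-reflexive (sym q≡2t+1)) (≤-trans (≤-reflexive q≡2t+1) (ℕ.n≤1+n _)))
  even-case : 2 ∣ q → Rex (q ∸ 2)
  -- The quotient 0, at which `q ∸ 2` would truncate, is excluded because `n ∸ 2 * m ≤ n`.
  even-case (divides zero q≡0) = contradiction (quot>0 n m h) (ℕ.<-irrefl (sym q≡0))
  even-case (divides (suc t) q≡t*2+2) = subst Rex (sym (cong (_∸ 2) q≡2t+2))
    (isRex n m h t (≤-trans (ℕ.n≤1+n _) (≤-reflexive (sym q≡2t+2))) (≤-reflexive q≡2t+2))
    where
    q≡2t+2 : q ≡ 2 + 2 * t
    q≡2t+2 = trans q≡t*2+2 (cong (2 +_) (*-comm t 2))
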